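{- Let $P\in\mathbb{Z}[x]$ be a monic irreducible polynomial of degree $d$ with constant coefficient $a_0$. Let $n>1$ have prime factorisation $n=p_1^{k_1}\cdots p_l^{k_l}$ (with $l$ distinct primes) and put $n'=p_1^{k_1-1}\cdots p_l^{k_l-1}$. Then $U(n)$ is divisible by $$a_0^{\,n'\,2^{2(l-1)}\,d^{2^l-2}}.$$
   Context: Let $\alpha_1,\dots,\alpha_d$ be the roots of $P$. For $n>1$ let $\mathcal{D}_+(n)=\{m\mid n:\mu(n/m)=1\}$ and $\mathcal{D}_-(n)=\{m\mid n:\mu(n/m)=-1\}$ ($\mu$ the Möbius function); each has $r=2^{l-1}$ elements. For a multiset $\mathcal{N}=\{n_1,\dots,n_r\}$ of positive integers let $P_{\mathcal{N}}(x)=\prod_{j_1,\dots,j_r=1}^d(x-\alpha_{j_1}^{n_1}\cdots\alpha_{j_r}^{n_r})\in\mathbb{Z}[x]$. Then $U(n):=\operatorname{Res}(P_{\mathcal{D}_+(n)},P_{\mathcal{D}_-(n)})\in\mathbb{Z}$, where for monic $A,B$, $\operatorname{Res}(A,B)=\prod_{A(a)=0,B(b)=0}(a-b)$. Equivalently, $U(n)$ is the product, over all choices of indices $j_m\in\{1,\dots,d\}$ for each $m\in\mathcal{D}_+(n)\cup\mathcal{D}_-(n)$, of $\prod_{m\in\mathcal{D}_+(n)}\alpha_{j_m}^m-\prod_{m\in\mathcal{D}_-(n)}\alpha_{j_m}^m$. -}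

module Defs where

open import Level using (Level)
open import Data.Nat as ℕ using (ℕ; zero; suc; NonZero)
open import Data.Nat.Properties using (m*n≢0)
open import Data.Nat.Divisibility using (_∣_; _∣?_)
open import Data.Nat.Primality using (prime?; Prime; productOfPrimes≢0)
open import Data.Nat.DivMod using (_/_)
open import Data.Integer as ℤ using (ℤ; +_; -[1+_])
open import Data.Fin using (Fin)
open import Data.List using (List; []; _∷_; map; filter; length; upTo; allFin; concatMap; foldr; _++_)
open import Data.Nat.ListAction using (product)
open import Data.Product using (Σ; _×_; _,_; ∃; proj₁)
open import Data.Sum using (_⊎_)
open import Data.Empty using (⊥)
open import Relation.Nullary using (¬_; ¬?; _×-dec_; Dec; yes; no)
open import Data.List.Relation.Unary.All as All using (All; all?)
open import Data.List.Relation.Unary.All.Properties using (all-filter)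
open import Relation.Unary using (Decidable)
open import Relation.Binary.PropositionalEquality using (_≡_)
open import Algebra.Bundles using (CommutativeRing)
open import Data.Integer.Properties using (+-*-commutativeRing)

-- Polynomials over a commutative ring, as coefficient lists
-- (lowest degree first).  Two lists represent the same polynomial
-- iff all their coefficients agree (missing coefficients are 0).

module Poly {c ℓ : Level} (R : CommutativeRing c ℓ) where
  open CommutativeRing R

  Pol : Set c
  Pol = List Carrier

  coeff : Pol → ℕ → Carrier
  coeff []       _       = 0#
  coeff (a ∷ _)  zero    = a
  coeff (_ ∷ p)  (suc i) = coeff p i

  _≈ₚ_ : Pol → Pol → Set ℓ
  p ≈ₚ q = ∀ i → coeff p i ≈ coeff q i

  _+ₚ_ : Pol → Pol → Pol
  []      +ₚ q       = q
  (a ∷ p) +ₚ []      = a ∷ p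
  (a ∷ p) +ₚ (b ∷ q) = (a + b) ∷ (p +ₚ q)

  _*ₚ_ : Pol → Pol → Pol
  []      *ₚ q = []
  (a ∷ p) *ₚ q = map (a *_) q +ₚ (0# ∷ (p *ₚ q))

  const : Carrier → Pol
  const a = a ∷ []

  X-_ : Carrier → Pol
  X- a = (- a) ∷ 1# ∷ []

  prodₚ : List Pol → Pol
  prodₚ = foldr _*ₚ_ (const 1#)

  _^′_ : Carrier → ℕ → Carrier
  a ^′ zero  = 1#
  a ^′ suc k = a * (a ^′ k)

  prodR : List Carrier → Carrier
  prodR = foldr _*_ 1#

  ιℕ : ℕ → Carrier
  ιℕ zero    = 0#
  ιℕ (suc k) = 1# + ιℕ k

  ι : ℤ → Carrier
  ι (+ k)       = ιℕ k
  ι -[1+ k ]    = - ιℕ (suc k)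

module ℤP = Poly +-*-commutativeRing

monic : (d : ℕ) → (Fin d → ℤ) → List ℤ
monic d a = map a (allFin d) ++ (+ 1 ∷ [])

IsUnitℤX : List ℤ → Set
IsUnitℤX u = (u ℤP.≈ₚ ℤP.const (+ 1)) ⊎ (u ℤP.≈ₚ ℤP.const (ℤ.- (+ 1)))

IrreducibleℤX : List ℤ → Set
IrreducibleℤX f = ¬ IsUnitℤX f
                × (∀ g h → f ℤP.≈ₚ (g ℤP.*ₚ h) → IsUnitℤX g ⊎ IsUnitℤX h)

primeDivisors : ℕ → List ℕ
primeDivisors n = filter (λ p → prime? p ×-dec (p ∣? n)) (upTo (suc n))

ω : ℕ → ℕ
ω n = length (primeDivisors n)

-- squarefree: no k ≥ 2 with k² ∣ n  (k ranges over 2 … n+1, which suffices)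
Squarefree : ℕ → Set
Squarefree n = All (λ k → ¬ (suc (suc k) ℕ.* suc (suc k) ∣ n)) (upTo n)

squarefree? : (n : ℕ) → Dec (Squarefree n)
squarefree? n = all? (λ k → ¬? (suc (suc k) ℕ.* suc (suc k) ∣? n)) (upTo n)

μ : ℕ → ℤ
μ n with squarefree? n
... | yes _ = (ℤ.- (+ 1)) ℤ.^ ω n
... | no  _ = + 0

rad : ℕ → ℕ
rad n = product (primeDivisors n)

rad≢0 : ∀ n → NonZero (rad n)
rad≢0 n = productOfPrimes≢0
    (All.map proj₁ (all-filter (λ p → prime? p ×-dec (p ∣? n)) (upTo (suc n))))

-- n' = p₁^(k₁-1) ⋯ p_l^(k_l-1) = n / rad n
n′ : ℕ → ℕ
n′ n = _/_ n (rad n) {{rad≢0 n}}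

𝒟 : ℤ → ℕ → List ℕ
𝒟 s n = map suc (filter (λ k → (suc k ∣? n) ×-dec (μ (n / suc k) ℤ.≟ s)) (upTo n))

𝒟₊ 𝒟₋ : ℕ → List ℕ
𝒟₊ = 𝒟 (+ 1)
𝒟₋ = 𝒟 (ℤ.- (+ 1))

exponent : ℕ → ℕ → ℕ
exponent d n = n′ n ℕ.* (2 ℕ.^ (2 ℕ.* (ω n ℕ.∸ 1))) ℕ.* (d ℕ.^ ((2 ℕ.^ ω n) ℕ.∸ 2))

-- U(n), computed in a commutative ring K containing the roots α₁ … α_d

module UDef {c ℓ : Level} (K : CommutativeRing c ℓ) (d : ℕ) (α : Fin d → CommutativeRing.Carrier K) where
  open CommutativeRing K
  open Poly K

  -- for a multiset 𝒩 = {n₁,…,n_r}: the list (with multiplicity) of all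
  -- products α_{j₁}^{n₁} ⋯ α_{j_r}^{n_r}, i.e. the roots of P_𝒩
  roots : List ℕ → List Carrier
  roots []      = 1# ∷ []
  roots (m ∷ 𝒩) = concatMap (λ t → map (λ j → (α j ^′ m) * t) (allFin d)) (roots 𝒩)

  -- Res(A,B) = ∏ (a - b) over roots a of A and b of B
  Res : List Carrier → List Carrier → Carrier
  Res as bs = prodR (concatMap (λ a → map (λ b → a - b) bs) as)

  U : ℕ → Carrier
  U n = Res (roots (𝒟₊ n)) (roots (𝒟₋ n))

{-# OPTIONS --safe #-}
module Submission where

-- U(n) is a product of differences α^u − α^v of monomials in the roots. Pulling α^min(u,v) out of
-- each factor gives U = (α₁ ⋯ α_d)^E · c for an integer polynomial c in the roots, as soon as every
-- total exponent T_i = Σ min(u_i, v_i) is at least E. With X = Σ 𝒟₊(n) and Y = Σ 𝒟₋(n) one has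
-- min(u_i, v_i) · max(X, Y) ≥ u_i v_i, and summing over all index choices gives
-- T_i ≥ d^(2^l − 2) · min(X, Y), while X, Y ≥ n′ · 4^(l − 1).
--
-- Integrality of c: if a₀^E = 0 then U(n) = 0; otherwise c is invariant under permuting the roots, because U and
-- α₁ ⋯ α_d are. Hence d! · c^N is, for every N, a sum of an integer polynomial over all
-- permutations of the roots, and such a sum is an integer by Newton's identities. A rational
-- number all of whose powers have a bounded denominator is an integer.

open import Defs
open import Level using (Level)
open import Algebra.Bundles using (CommutativeRing; CommutativeMonoid)
open import Data.Bool using (Bool; true; false; not)
open import Data.Fin using (Fin; zero; suc)
open import Data.Fin.Properties using (nonZeroIndex)
open import Data.Integer as ℤ using (ℤ; 0ℤ; 1ℤ; -1ℤ)
open import Data.Integer.Divisibility.Signed using (∣ᵤ⇒∣; divides)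
import Data.Integer.Properties as ℤₚ
open import Data.List using (List; []; _∷_; map; _++_; length; concatMap; foldr; upTo; allFin; tabulate)
open import Data.List.Properties using (length-++; length-map; length-tabulate; map-id; map-∘; map-tabulate; ++-identityʳ)
open import Data.List.Membership.Propositional using (_∈_)
open import Data.List.Membership.Propositional.Properties using (∈-map⁺; ∈-map⁻; ∈-++⁻; ∈-∃++; ∈-filter⁺; ∈-upTo⁺)
open import Data.List.Relation.Binary.Permutation.Propositional using (_↭_; ↭-refl; ↭-sym; ↭-trans; prep; swap; ↭⇒↭ₛ′)
import Data.List.Relation.Binary.Permutation.Propositional.Properties as ↭
open import Data.List.Relation.Binary.Permutation.Setoid.Properties using (foldr-commMonoid)
open import Data.List.Relation.Binary.Sublist.Propositional using (_⊆_; []; _∷ʳ_; _∷_)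
open import Data.List.Relation.Binary.Sublist.Propositional.Properties using (All-resp-⊆)
open import Data.List.Relation.Unary.All as All using (All; []; _∷_)
import Data.List.Relation.Unary.All.Properties as Allₚ
open import Data.List.Relation.Unary.AllPairs using (AllPairs; []; _∷_)
import Data.List.Relation.Unary.AllPairs.Properties as AllPairsₚ
open import Data.List.Relation.Unary.Any using (here; there)
open import Data.List.Relation.Unary.Unique.Propositional using (Unique)
import Data.List.Relation.Unary.Unique.Propositional.Properties as Uniqueₚ
open import Data.Maybe using (Maybe; just; nothing)
open import Data.Nat as ℕ using (ℕ; zero; suc; _≤_; _<_; _∸_; _⊓_; z≤n; s≤s; NonZero; ≢-nonZero; ≢-nonZero⁻¹; nonTrivial⇒n>1)
open import Data.Nat.Coprimality as Cop using (Coprime; coprime-divisor; coprime-/gcd; 1-coprimeTo)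
open import Data.Nat.Divisibility hiding (divides)
open import Data.Nat.DivMod using (_/_; m*n/n≡m; m/n*n≡m)
open import Data.Nat.GCD using (gcd; gcd[m,n]∣m; gcd[m,n]∣n; gcd[m,n]≢0)
open import Data.Nat.ListAction using (sum; product)
open import Data.Nat.ListAction.Properties using (sum-++; sum-↭; ∈⇒∣product)
open import Data.Nat.Primality
open import Data.Nat.Primality.Factorisation using (factorise; PrimeFactorisation)
import Data.Nat.Properties as ℕₚ
open import Data.Nat.Tactic.RingSolver using (solve-∀)
open import Data.Product using (∃; _×_; _,_; proj₁; proj₂)
open import Data.Sum using (_⊎_; inj₁; inj₂)
open import Data.Vec.Functional using (Vector; updateAt) renaming (_∷_ to _◂_; [] to ⟨⟩)
open import Function using (_∘_; id)
open import Relation.Nullary using (¬_; yes; no; contradiction; _×-dec_)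
open import Relation.Binary.PropositionalEquality as ≡ using (_≡_; _≢_)

-- Averaging over all orderings of the roots takes the place of Galois invariance. It needs only
-- power sums, not the fundamental theorem on symmetric polynomials, but it brings in the factor d!.
-- This factor is the same for every exponent N, and that is why all powers of c are considered
-- instead of c alone.
--
-- The passage from min(u,v) to u v is forced by the summation: u and v vary over independent index
-- choices, so the sum of u v splits into two factors, while the sum of minima has no such form. The
-- divisor max(X, Y) bounds every single exponent and turns X Y into min(X, Y).

private variable
  a b : Level
  A : Set a
  B : Set b

-- Divisibility of powers, and comparison of duplicate-free lists.

module Arithmetic where
  open import Data.Nat using (_+_; _*_; _^_)
  open ≡ using (refl; sym; trans; cong; cong₂; subst; subst₂)

  Coprime-*ʳ : ∀ {k a b} → Coprime k a → Coprime k b → Coprime k (a * b)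
  Coprime-*ʳ c₁ c₂ (i∣k , i∣ab) =
    c₂ (i∣k , coprime-divisor (λ (j∣i , j∣a) → c₁ (∣-trans j∣i i∣k , j∣a)) i∣ab)

  Coprime-^ʳ : ∀ {k a} n → Coprime k a → Coprime k (a ^ n)
  Coprime-^ʳ zero    c = Cop.sym (1-coprimeTo _)
  Coprime-^ʳ (suc n) c = Coprime-*ʳ c (Coprime-^ʳ n c)

  ^-distribʳ-* : ∀ n a b → (a * b) ^ n ≡ a ^ n * b ^ n
  ^-distribʳ-* zero    a b = refl
  ^-distribʳ-* (suc n) a b = trans (cong (a * b *_) (^-distribʳ-* n a b)) (lem a b (a ^ n) (b ^ n))
    where
    lem : ∀ a b x y → a * b * (x * y) ≡ a * x * (b * y)
    lem = solve-∀

  n<2^n : ∀ n → n < 2 ^ n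
  n<2^n zero    = s≤s z≤n
  n<2^n (suc n) = subst (suc (suc n) ≤_) (cong (2 ^ n +_) (sym (ℕₚ.+-identityʳ (2 ^ n))))
                    (ℕₚ.+-mono-≤ (ℕₚ.^-monoʳ-≤ 2 (z≤n {n})) (n<2^n n))

  -- Divide both numbers by their gcd g: D = D′ g and m = m′ g with D′, m′ coprime. Cancelling g^N
  -- leaves D′^N ∣ m′^(N+1) g, hence D′^N ∣ g for every N. For D′ ≥ 2 and N = g this contradicts g <
  -- 2^g, so D′ = 1.
  ∣-of-powers : ∀ D m → NonZero D → (∀ N → D ^ N ∣ m ^ suc N) → D ∣ m
  ∣-of-powers D@(suc _) m D≢0 h = subst (_∣ m) (sym D≡g) (gcd[m,n]∣n D m)
    where
    g = gcd D m
    instance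
      g≢0 : NonZero g
      g≢0 = ≢-nonZero (gcd[m,n]≢0 D m (inj₁ λ ()))
    D′ = D / g
    m′ = m / g
    D≡ : D ≡ D′ * g
    D≡ = sym (m/n*n≡m (gcd[m,n]∣m D m))
    m≡ : m ≡ m′ * g
    m≡ = sym (m/n*n≡m (gcd[m,n]∣n D m))
    pow∣ : ∀ N → D′ ^ N ∣ g
    pow∣ N = coprime-divisor (Coprime-^ʳ (suc N) (Cop.sym (Coprime-^ʳ N (Cop.sym (coprime-/gcd D m)))))
      (*-cancelʳ-∣ (g ^ N) {{ℕₚ.m^n≢0 g N}} (subst₂ _∣_
        (trans (cong (_^ N) D≡) (^-distribʳ-* N D′ g))
        (trans (cong (_^ suc N) m≡) (trans (^-distribʳ-* (suc N) m′ g) (sym (ℕₚ.*-assoc (m′ ^ suc N) g (g ^ N)))))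
        (h N)))
    go : ∀ D′ → (∀ N → D′ ^ N ∣ g) → D ≡ D′ * g → D ≡ g
    go zero          _ ()
    go (suc zero)    _ eq = trans eq (ℕₚ.*-identityˡ g)
    go (suc (suc k)) p _ = contradiction (ℕₚ.<-≤-trans (n<2^n g)
      (ℕₚ.≤-trans (ℕₚ.^-monoˡ-≤ g (s≤s (s≤s (z≤n {k})))) (∣⇒≤ (p g)))) (ℕₚ.<-irrefl refl)
    D≡g : D ≡ g
    D≡g = go D′ pow∣ D≡

  -- Naming the leftover list `zs` serves two purposes: sums and lengths both compare by dropping
  -- it.
  Unique-⊆⇒↭ : ∀ {a} {A : Set a} {xs ys : List A} → Unique xs → (∀ {x} → x ∈ xs → x ∈ ys) →
    ∃ λ zs → ys ↭ xs ++ zs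
  Unique-⊆⇒↭ {xs = []}     {ys} _          _   = ys , ↭-refl
  Unique-⊆⇒↭ {xs = x ∷ xs} {ys} (x∉ ∷ uxs) sub
    with as , bs , refl ← ∈-∃++ (sub (here refl)) =
    let zs , p = Unique-⊆⇒↭ {ys = as ++ bs} uxs sub′ in zs , ↭-trans (↭.shift x as bs) (prep x p)
    where
    sub′ : ∀ {y} → y ∈ xs → y ∈ as ++ bs
    sub′ y∈ with ↭.∈-resp-↭ (↭.shift x as bs) (sub (there y∈))
    ... | here refl = contradiction refl (All.lookup x∉ y∈)
    ... | there q   = q

  module _ {xs ys : List ℕ} (uxs : Unique xs) (sub : ∀ {x} → x ∈ xs → x ∈ ys) where

    sum-mono : sum xs ≤ sum ys
    sum-mono with zs , p ← Unique-⊆⇒↭ uxs sub =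
      subst (sum xs ≤_) (sym (trans (sum-↭ p) (sum-++ xs zs))) (ℕₚ.m≤m+n _ _)

    length-mono : length xs ≤ length ys
    length-mono with zs , p ← Unique-⊆⇒↭ uxs sub =
      subst (length xs ≤_) (sym (trans (↭.↭-length p) (length-++ xs))) (ℕₚ.m≤m+n _ _)

  AllPairs-resp-⊆ : ∀ {a ℓ} {A : Set a} {R : A → A → Set ℓ} {xs ys : List A} → xs ⊆ ys → AllPairs R ys → AllPairs R xs
  AllPairs-resp-⊆ []         []        = []
  AllPairs-resp-⊆ (_ ∷ʳ sub) (_ ∷ rs)  = AllPairs-resp-⊆ sub rs
  AllPairs-resp-⊆ (refl ∷ sub) (r ∷ rs) = All-resp-⊆ sub r ∷ AllPairs-resp-⊆ sub rs

  -- Prime divisors and products of distinct primes.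

  ∃-prime-divisor : ∀ {n} → 1 < n → ∃ λ p → Prime p × p ∣ n
  ∃-prime-divisor {n@(suc _)} 1<n = go (factorise n)
    where
    go : PrimeFactorisation n → _
    go record { factors = []     ; isFactorisation = n≡1 } = contradiction 1<n (ℕₚ.<-irrefl (sym n≡1))
    go record { factors = p ∷ ps ; isFactorisation = n≡  ; factorsPrime = pp ∷ _ } =
      p , pp , subst (p ∣_) (sym n≡) (m∣m*n _)

  prime∣prime⇒≡ : ∀ {p q} → Prime p → Prime q → p ∣ q → p ≡ q
  prime∣prime⇒≡ pp pq p∣q with prime⇒irreducible pq p∣q
  ... | inj₁ refl = contradiction pp ¬prime[1]
  ... | inj₂ p≡q  = p≡q

  prime∣product⇒∈ : ∀ {p qs} → Prime p → All Prime qs → p ∣ product qs → p ∈ qs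
  prime∣product⇒∈ pp [] p∣1 = contradiction (subst Prime (∣1⇒≡1 p∣1) pp) ¬prime[1]
  prime∣product⇒∈ {qs = q ∷ qs} pp (pq ∷ pqs) p∣ with euclidsLemma q (product qs) pp p∣
  ... | inj₁ p∣q  = here (prime∣prime⇒≡ pp pq p∣q)
  ... | inj₂ p∣qs = there (prime∣product⇒∈ pp pqs p∣qs)

  p∤product : ∀ {p ps} → Prime p → All Prime ps → All (p ≢_) ps → ¬ p ∣ product ps
  p∤product pp pps p∉ p∣ = All.lookup p∉ (prime∣product⇒∈ pp pps p∣) refl

  -- If p is the first factor, one p cancels and the other would have to divide the remaining
  -- primes. Otherwise p² is coprime to the first factor and must divide the rest.
  p²∤product : ∀ {p qs} → Prime p → All Prime qs → Unique qs → ¬ p * p ∣ product qs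
  p²∤product {qs = []}     pp []         _          p²∣ = p∤product pp [] [] (m*n∣⇒m∣ _ _ p²∣)
  p²∤product {p} {qs = q ∷ qs} pp (pq ∷ pqs) (q∉ ∷ uqs) p²∣
    with prime∣product⇒∈ pp (pq ∷ pqs) (m*n∣⇒m∣ p p p²∣)
  ... | here refl = p∤product pp pqs q∉ (*-cancelˡ-∣ p {{prime⇒nonZero pp}} p²∣)
  ... | there p∈  = p²∤product pp pqs uqs (coprime-divisor {n = q} cop p²∣)
    where
    cop-p : Coprime q p
    cop-p {i} (i∣q , i∣p) with prime⇒irreducible pq i∣q
    ... | inj₁ i≡1  = i≡1
    ... | inj₂ refl = contradiction (prime∣prime⇒≡ pq pp i∣p) (All.lookup q∉ p∈)
    cop : Coprime (p * p) q
    cop = Cop.sym (Coprime-*ʳ cop-p cop-p)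

  -- A square k² with k ≥ 2 contains p² for any prime p dividing k, so squares of primes are enough.
  squarefree-product : ∀ {qs} → All Prime qs → Unique qs → Squarefree (product qs)
  squarefree-product {qs} pqs uqs = All.universal go (upTo (product qs))
    where
    go : ∀ k → ¬ suc (suc k) * suc (suc k) ∣ product qs
    go k k²∣ with p , pp , p∣k ← ∃-prime-divisor {suc (suc k)} (s≤s (s≤s z≤n)) =
      p²∤product {qs = qs} pp pqs uqs (∣-trans (*-pres-∣ p∣k p∣k) k²∣)

  primeDivisors-prime : ∀ n → All Prime (primeDivisors n)
  primeDivisors-prime n = All.map proj₁ (Allₚ.all-filter (λ p → prime? p ×-dec (p ∣? n)) (upTo (suc n)))

  primeDivisors-∣ : ∀ n → All (_∣ n) (primeDivisors n)
  primeDivisors-∣ n = All.map proj₂ (Allₚ.all-filter (λ p → prime? p ×-dec (p ∣? n)) (upTo (suc n)))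

  ∈-primeDivisors : ∀ {p n} → .{{NonZero n}} → Prime p → p ∣ n → p ∈ primeDivisors n
  ∈-primeDivisors {n = n} pp p∣n = ∈-filter⁺ (λ p → prime? p ×-dec (p ∣? n)) (∈-upTo⁺ (s≤s (∣⇒≤ p∣n))) (pp , p∣n)

  primeDivisors-unique : ∀ n → Unique (primeDivisors n)
  primeDivisors-unique n = Uniqueₚ.filter⁺ (λ p → prime? p ×-dec (p ∣? n)) (Uniqueₚ.upTo⁺ (suc n))

  -- The order makes the head of the list the smallest prime, so that all other primes are at least
  -- 3.
  primeDivisors-sorted : ∀ n → AllPairs _<_ (primeDivisors n)
  primeDivisors-sorted n = AllPairsₚ.filter⁺ (λ p → prime? p ×-dec (p ∣? n))
    (AllPairsₚ.applyUpTo⁺₁ id (suc n) (λ i<j _ → i<j))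

  ω-product : ∀ {qs} → All Prime qs → Unique qs → ω (product qs) ≡ length qs
  ω-product {qs} pqs uqs = ℕₚ.≤-antisym
    (length-mono (primeDivisors-unique k) λ p∈ →
      prime∣product⇒∈ (All.lookup (primeDivisors-prime k) p∈) pqs (All.lookup (primeDivisors-∣ k) p∈))
    (length-mono uqs λ q∈ → ∈-primeDivisors {{productOfPrimes≢0 pqs}} (All.lookup pqs q∈) (∈⇒∣product q∈))
    where k = product qs

  μ-squarefree : ∀ {k} → Squarefree k → μ k ≡ -1ℤ ℤ.^ ω k
  μ-squarefree {k} sf with squarefree? k
  ... | yes _  = refl
  ... | no ¬sf = contradiction sf ¬sf

  product-primes-∣ : ∀ {n ps} → All Prime ps → Unique ps → All (_∣ n) ps → product ps ∣ n
  product-primes-∣ {n} [] _ _ = 1∣ n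
  product-primes-∣ {ps = p ∷ ps} (pp ∷ pps) (p∉ ∷ ups) (divides-refl k ∷ ps∣) =
    subst (p * product ps ∣_) (ℕₚ.*-comm p k) (*-monoʳ-∣ p
      (coprime-divisor {n = p} cop (subst (product ps ∣_) (ℕₚ.*-comm k p) (product-primes-∣ pps ups ps∣))))
    where
    cop : Coprime (product ps) p
    cop {i} (i∣ps , i∣p) with prime⇒irreducible pp i∣p
    ... | inj₁ i≡1  = i≡1
    ... | inj₂ refl = contradiction i∣ps (p∤product pp pps p∉)

  -- Divisors of the radical, split by sign, and their sums.

  sgn : Bool → ℤ
  sgn true  = 1ℤ
  sgn false = -1ℤ

  -- For distinct primes ps, the divisors e of product ps with μ (product ps / e) = sgn b.
  signedDivisors : Bool → List ℕ → List ℕ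
  signedDivisors true  []       = 1 ∷ []
  signedDivisors false []       = []
  signedDivisors b     (p ∷ ps) = map (p *_) (signedDivisors b ps) ++ signedDivisors (not b) ps

  -- `qs` collects the primes missing from `e`, that is, the prime factors of the complementary
  -- divisor. Putting p into `e` leaves `qs` and the sign alone; leaving p out enlarges `qs` by one
  -- and flips the sign.
  ∈-signedDivisors : ∀ b ps {e} → e ∈ signedDivisors b ps →
    ∃ λ qs → qs ⊆ ps × e * product qs ≡ product ps × -1ℤ ℤ.^ length qs ≡ sgn b
  ∈-signedDivisors true [] (here refl) = [] , [] , refl , refl
  ∈-signedDivisors b (p ∷ ps) {e} e∈ with ∈-++⁻ (map (p *_) (signedDivisors b ps)) (unfold b e∈)
    where
    unfold : ∀ b → e ∈ signedDivisors b (p ∷ ps) → e ∈ map (p *_) (signedDivisors b ps) ++ signedDivisors (not b) ps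
    unfold true  = id
    unfold false = id
  ... | inj₁ e∈ₗ with e′ , e′∈ , refl ← ∈-map⁻ (p *_) e∈ₗ
                with qs , sub , eq , sg ← ∈-signedDivisors b ps e′∈ =
    qs , p ∷ʳ sub , trans (ℕₚ.*-assoc p e′ _) (cong (p *_) eq) , sg
  ... | inj₂ e∈ᵣ with qs , sub , eq , sg ← ∈-signedDivisors (not b) ps e∈ᵣ =
    p ∷ qs , refl ∷ sub , trans (lem e p (product qs)) (cong (p *_) eq) , trans (cong (-1ℤ ℤ.*_) sg) (sgn-not b)
    where
    lem : ∀ e p q → e * (p * q) ≡ p * (e * q)
    lem = solve-∀
    sgn-not : ∀ b → -1ℤ ℤ.* sgn (not b) ≡ sgn b
    sgn-not true  = refl
    sgn-not false = refl

  signedDivisors-unique : ∀ b {ps} → All Prime ps → Unique ps → Unique (signedDivisors b ps)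
  signedDivisors-unique true  [] _ = [] ∷ []
  signedDivisors-unique false [] _ = []
  signedDivisors-unique b {p ∷ ps} (pp ∷ pps) (p∉ ∷ ups) = fold b (Uniqueₚ.++⁺
    (Uniqueₚ.map⁺ (ℕₚ.*-cancelˡ-≡ _ _ p {{prime⇒nonZero pp}}) (signedDivisors-unique b pps ups))
    (signedDivisors-unique (not b) pps ups)
    disj)
    where
    fold : ∀ b → Unique (map (p *_) (signedDivisors b ps) ++ signedDivisors (not b) ps) → Unique (signedDivisors b (p ∷ ps))
    fold true  = id
    fold false = id
    disj : ∀ {v} → ¬ (v ∈ map (p *_) (signedDivisors b ps) × v ∈ signedDivisors (not b) ps)
    disj (v∈ₗ , v∈ᵣ) with e , _ , refl ← ∈-map⁻ (p *_) v∈ₗ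
                     with qs , _ , eq , _ ← ∈-signedDivisors (not b) ps v∈ᵣ =
      -- A common element is a multiple of p, yet it divides the product of the other primes.
      p∤product pp pps p∉ (subst (p ∣_) eq (∣m⇒∣m*n _ (m∣m*n e)))

  sum-map-* : ∀ p xs → sum (map (p *_) xs) ≡ p * sum xs
  sum-map-* p []       = sym (ℕₚ.*-zeroʳ p)
  sum-map-* p (x ∷ xs) = trans (cong (p * x +_) (sum-map-* p xs)) (sym (ℕₚ.*-distribˡ-+ p x _))

  sum-signedDivisors-∷ : ∀ b p ps →
    sum (signedDivisors b (p ∷ ps)) ≡ p * sum (signedDivisors b ps) + sum (signedDivisors (not b) ps)
  sum-signedDivisors-∷ true  p ps = trans (sum-++ (map (p *_) (signedDivisors true ps)) _) (cong (_+ _) (sum-map-* p (signedDivisors true ps)))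
  sum-signedDivisors-∷ false p ps = trans (sum-++ (map (p *_) (signedDivisors false ps)) _) (cong (_+ _) (sum-map-* p (signedDivisors false ps)))

  -- The total is taken because the two lengths differ for the empty list (1 and 0); they become
  -- equal only from the first prime on.
  length-signedDivisors : ∀ ps → length (signedDivisors true ps) + length (signedDivisors false ps) ≡ 2 ^ length ps
  length-signedDivisors []       = refl
  length-signedDivisors (p ∷ ps) = trans
    (cong₂ _+_ (len (signedDivisors true ps) (signedDivisors false ps)) (len (signedDivisors false ps) (signedDivisors true ps)))
    (trans (lem (length (signedDivisors true ps)) _) (cong (2 *_) (length-signedDivisors ps)))
    where
    len : ∀ xs ys → length (map (p *_) xs ++ ys) ≡ length xs + length ys
    len xs ys = trans (length-++ (map (p *_) xs)) (cong (_+ length ys) (length-map (p *_) xs))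
    lem : ∀ x y → x + y + (y + x) ≡ 2 * (x + y)
    lem = solve-∀

  -- Both signs together give the sum of all divisors, which is the product of the factors p + 1,
  -- and each of these is at least 4.
  sum-signedDivisors : ∀ ps → All (3 ≤_) ps →
    4 ^ length ps ≤ sum (signedDivisors true ps) + sum (signedDivisors false ps)
  sum-signedDivisors []       []           = s≤s z≤n
  sum-signedDivisors (p ∷ ps) (3≤p ∷ 3≤ps) = begin
    4 * 4 ^ length ps                ≤⟨ ℕₚ.*-mono-≤ (s≤s 3≤p) (sum-signedDivisors ps 3≤ps) ⟩
    suc p * (X + Y)                  ≡⟨ lem p X Y ⟩
    p * X + Y + (p * Y + X)          ≡⟨ cong₂ _+_ (sum-signedDivisors-∷ true p ps) (sum-signedDivisors-∷ false p ps) ⟨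
    sum (signedDivisors true (p ∷ ps)) + sum (signedDivisors false (p ∷ ps)) ∎
    where
    open ℕₚ.≤-Reasoning
    X = sum (signedDivisors true ps)
    Y = sum (signedDivisors false ps)
    lem : ∀ p X Y → suc p * (X + Y) ≡ p * X + Y + (p * Y + X)
    lem = solve-∀

  -- The smallest prime p is spent on balancing the signs: p X + Y ≥ X + Y bounds either part from
  -- below by the full divisor sum of the remaining primes. These exceed p ≥ 2, hence are at least
  -- 3. This is where the exponent l - 1 comes from.
  sum-signedDivisors≥ : ∀ b ps → 0 < length ps → All Prime ps → AllPairs _<_ ps →
    4 ^ (length ps ∸ 1) ≤ sum (signedDivisors b ps)
  sum-signedDivisors≥ b (p ∷ ps) _ (pp ∷ _) (p< ∷ _) = begin
    4 ^ length ps                  ≤⟨ sum-signedDivisors ps (All.map (ℕₚ.<-≤-trans (s≤s (nonTrivial⇒n>1 p {{prime⇒nonTrivial pp}}))) p<) ⟩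
    X true + X false               ≡⟨ comm b ⟩
    X b + X (not b)                ≤⟨ ℕₚ.+-monoˡ-≤ (X (not b)) (ℕₚ.m≤n*m (X b) p {{prime⇒nonZero pp}}) ⟩
    p * X b + X (not b)            ≡⟨ sum-signedDivisors-∷ b p ps ⟨
    sum (signedDivisors b (p ∷ ps)) ∎
    where
    open ℕₚ.≤-Reasoning
    X : Bool → ℕ
    X b = sum (signedDivisors b ps)
    comm : ∀ b → X true + X false ≡ X b + X (not b)
    comm true  = refl
    comm false = ℕₚ.+-comm (X true) _

  ∈-𝒟 : ∀ {s} m Q {n} → .{{NonZero n}} → m * Q ≡ n → μ Q ≡ s → m ∈ 𝒟 s n
  ∈-𝒟 zero Q {{()}} refl _
  ∈-𝒟 {s} (suc k) Q refl μQ = ∈-map⁺ suc (∈-filter⁺ _ (∈-upTo⁺ (∣⇒≤ (m∣m*n Q)))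
    (m∣m*n Q , trans (cong μ (trans (cong (_/ suc k) (ℕₚ.*-comm (suc k) Q)) (m*n/n≡m Q (suc k)))) μQ))

  module _ (n : ℕ) .{{n≢0 : NonZero n}} where

    private
      ps  = primeDivisors n
      pps = primeDivisors-prime n
      ups = primeDivisors-unique n

    n′*rad : n′ n * rad n ≡ n
    n′*rad = m/n*n≡m {{rad≢0 n}} (product-primes-∣ pps ups (primeDivisors-∣ n))

    -- The divisors m of n with n/m squarefree are the numbers n′ e with e dividing rad n, and then
    -- n/m = rad n / e. Lower bounds on sums and lengths are the goal, so the inclusion into `𝒟` is
    -- the direction that gets proved.
    scaledDivisors : Bool → List ℕ
    scaledDivisors b = map (n′ n *_) (signedDivisors b ps)

    scaledDivisors-unique : ∀ b → Unique (scaledDivisors b)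
    scaledDivisors-unique b = Uniqueₚ.map⁺ (ℕₚ.*-cancelˡ-≡ _ _ (n′ n) {{n′≢0}}) (signedDivisors-unique b pps ups)
      where
      n′≢0 : NonZero (n′ n)
      n′≢0 = ℕₚ.m*n≢0⇒m≢0 (n′ n) {rad n} {{subst NonZero (sym n′*rad) (≢-nonZero (≢-nonZero⁻¹ n))}}

    scaledDivisors⊆𝒟 : ∀ b {m} → m ∈ scaledDivisors b → m ∈ 𝒟 (sgn b) n
    scaledDivisors⊆𝒟 b m∈ with e , e∈ , refl ← ∈-map⁻ (n′ n *_) m∈
                           with qs , sub , eq , sg ← ∈-signedDivisors b ps e∈ =
      ∈-𝒟 (n′ n * e) (product qs)
        (trans (ℕₚ.*-assoc (n′ n) e _) (trans (cong (n′ n *_) eq) n′*rad))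
        (trans (μ-squarefree (squarefree-product pqs uqs)) (trans (cong (-1ℤ ℤ.^_) (ω-product pqs uqs)) sg))
      where
      pqs = All-resp-⊆ sub pps
      uqs = AllPairs-resp-⊆ sub ups

    2^ω≤length : 2 ^ ω n ≤ length (𝒟₊ n) + length (𝒟₋ n)
    2^ω≤length = subst (_≤ length (𝒟₊ n) + length (𝒟₋ n)) (trans
        (cong₂ _+_ (length-map (n′ n *_) (signedDivisors true ps)) (length-map (n′ n *_) (signedDivisors false ps)))
        (length-signedDivisors ps))
      (ℕₚ.+-mono-≤ (length-mono (scaledDivisors-unique true) (scaledDivisors⊆𝒟 true))
                   (length-mono (scaledDivisors-unique false) (scaledDivisors⊆𝒟 false)))

    ω-pos : 1 < n → 0 < ω n
    ω-pos 1<n with p , pp , p∣n ← ∃-prime-divisor 1<n with ps | ∈-primeDivisors pp p∣n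
    ... | _ ∷ _ | _ = s≤s z≤n

    sum-𝒟≥ : ∀ b → 1 < n → n′ n * 2 ^ (2 * (ω n ∸ 1)) ≤ sum (𝒟 (sgn b) n)
    sum-𝒟≥ b 1<n = begin
      n′ n * 2 ^ (2 * (ω n ∸ 1))         ≡⟨ cong (n′ n *_) (ℕₚ.^-*-assoc 2 2 (ω n ∸ 1)) ⟨
      n′ n * 4 ^ (ω n ∸ 1)               ≤⟨ ℕₚ.*-monoʳ-≤ (n′ n) (sum-signedDivisors≥ b ps (ω-pos 1<n) pps (primeDivisors-sorted n)) ⟩
      n′ n * sum (signedDivisors b ps)   ≡⟨ sum-map-* (n′ n) (signedDivisors b ps) ⟨
      sum (scaledDivisors b)             ≤⟨ sum-mono (scaledDivisors-unique b) (scaledDivisors⊆𝒟 b) ⟩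
      sum (𝒟 (sgn b) n)                  ∎
      where open ℕₚ.≤-Reasoning

open Arithmetic

-- Finite sums and products over lists.

module BigOperator {c ℓ} (M : CommutativeMonoid c ℓ) where
  open CommutativeMonoid M
  open import Relation.Binary.Reasoning.Setoid setoid

  big : List A → (A → Carrier) → Carrier
  big xs f = foldr _∙_ ε (map f xs)

  big-cong : ∀ (xs : List A) {f g} → (∀ x → f x ≈ g x) → big xs f ≈ big xs g
  big-cong []       f≈g = refl
  big-cong (x ∷ xs) f≈g = ∙-cong (f≈g x) (big-cong xs f≈g)

  big-cong-All : ∀ {xs : List A} {f g} → All (λ x → f x ≈ g x) xs → big xs f ≈ big xs g
  big-cong-All []          = refl
  big-cong-All (fx≈ ∷ f≈g) = ∙-cong fx≈ (big-cong-All f≈g)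

  big-map : ∀ (h : A → B) xs f → big (map h xs) f ≡ big xs (f ∘ h)
  big-map h xs f = ≡.cong (foldr _∙_ ε) (≡.sym (map-∘ xs))

  big-++ : ∀ (xs ys : List A) f → big (xs ++ ys) f ≈ big xs f ∙ big ys f
  big-++ []       ys f = sym (identityˡ _)
  big-++ (x ∷ xs) ys f = trans (∙-congˡ (big-++ xs ys f)) (sym (assoc _ _ _))

  big-concatMap : ∀ (h : A → List B) xs f → big (concatMap h xs) f ≈ big xs (λ x → big (h x) f)
  big-concatMap h []       f = refl
  big-concatMap h (x ∷ xs) f = trans (big-++ (h x) _ f) (∙-congˡ (big-concatMap h xs f))

  big-concatMap-map : ∀ {c} {C : Set c} (h : A → B → C) xs ys f →
    big (concatMap (λ x → map (h x) ys) xs) f ≈ big xs (λ x → big ys (λ y → f (h x y)))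
  big-concatMap-map h xs ys f = trans (big-concatMap _ xs f) (big-cong xs λ x → reflexive (big-map (h x) ys f))

  big-ε : ∀ (xs : List A) → big xs (λ _ → ε) ≈ ε
  big-ε []       = refl
  big-ε (x ∷ xs) = trans (identityˡ _) (big-ε xs)

  big-∙ : ∀ (xs : List A) f g → big xs (λ x → f x ∙ g x) ≈ big xs f ∙ big xs g
  big-∙ []       f g = sym (identityˡ _)
  big-∙ (x ∷ xs) f g = begin
    (f x ∙ g x) ∙ big xs (λ x → f x ∙ g x)  ≈⟨ ∙-congˡ (big-∙ xs f g) ⟩
    (f x ∙ g x) ∙ (big xs f ∙ big xs g)     ≈⟨ interchange (f x) (g x) _ _ ⟩
    (f x ∙ big xs f) ∙ (g x ∙ big xs g)     ∎
    where open import Algebra.Properties.CommutativeSemigroup commutativeSemigroup using (interchange)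

  big-swap : ∀ (xs : List A) (ys : List B) (f : A → B → Carrier) →
    big xs (λ x → big ys (f x)) ≈ big ys (λ y → big xs (λ x → f x y))
  big-swap []       ys f = sym (big-ε ys)
  big-swap (x ∷ xs) ys f = trans (∙-congˡ (big-swap xs ys f)) (sym (big-∙ ys _ _))

  big-↭ : ∀ {xs ys : List A} f → xs ↭ ys → big xs f ≈ big ys f
  big-↭ f xs↭ys = foldr-commMonoid setoid isCommutativeMonoid (↭⇒↭ₛ′ isEquivalence (↭.map⁺ f xs↭ys))

-- The homomorphism from ℤ to `K` and its image.

module Integers {c ℓ} (K : CommutativeRing c ℓ) where
  open CommutativeRing K
  open Poly K
  open import Data.Integer using (+_; -[1+_]; _⊖_)
  open import Algebra.Properties.Ring ring using (-‿distribˡ-*; -‿distribʳ-*; -‿involutive; -0#≈0#)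
  open import Algebra.Properties.AbelianGroup +-abelianGroup using (⁻¹-∙-comm)
  open import Relation.Binary.Reasoning.Setoid setoid

  ιℕ-+ : ∀ m n → ιℕ (m ℕ.+ n) ≈ ιℕ m + ιℕ n
  ιℕ-+ zero    n = sym (+-identityˡ _)
  ιℕ-+ (suc m) n = trans (+-congˡ (ιℕ-+ m n)) (sym (+-assoc _ _ _))

  ιℕ-* : ∀ m n → ιℕ (m ℕ.* n) ≈ ιℕ m * ιℕ n
  ιℕ-* zero    n = sym (zeroˡ _)
  ιℕ-* (suc m) n = begin
    ιℕ (n ℕ.+ m ℕ.* n)        ≈⟨ ιℕ-+ n (m ℕ.* n) ⟩
    ιℕ n + ιℕ (m ℕ.* n)       ≈⟨ +-cong (sym (*-identityˡ _)) (ιℕ-* m n) ⟩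
    1# * ιℕ n + ιℕ m * ιℕ n   ≈⟨ distribʳ _ _ _ ⟨
    (1# + ιℕ m) * ιℕ n        ∎

  ι-neg : ∀ i → ι (ℤ.- i) ≈ - ι i
  ι-neg (+ zero)  = sym -0#≈0#
  ι-neg (+ suc n) = refl
  ι-neg -[1+ n ]  = sym (-‿involutive _)

  ι-⊖ : ∀ m n → ι (m ⊖ n) ≈ ιℕ m - ιℕ n
  ι-⊖ m zero = sym (trans (+-congˡ -0#≈0#) (+-identityʳ _))
  ι-⊖ zero (suc n) = sym (+-identityˡ _)
  ι-⊖ (suc m) (suc n) = begin
    ι (suc m ⊖ suc n)              ≡⟨ ≡.cong ι (ℤₚ.[1+m]⊖[1+n]≡m⊖n m n) ⟩
    ι (m ⊖ n)                      ≈⟨ ι-⊖ m n ⟩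
    ιℕ m - ιℕ n                    ≈⟨ +-identityˡ _ ⟨
    0# + (ιℕ m - ιℕ n)             ≈⟨ +-congʳ (-‿inverseʳ 1#) ⟨
    (1# - 1#) + (ιℕ m - ιℕ n)      ≈⟨ interchange 1# (- 1#) _ _ ⟩
    (1# + ιℕ m) + (- 1# - ιℕ n)    ≈⟨ +-congˡ (⁻¹-∙-comm 1# (ιℕ n)) ⟩
    ιℕ (suc m) - ιℕ (suc n)        ∎
    where open import Algebra.Properties.CommutativeSemigroup +-commutativeSemigroup using (interchange)

  ι-+ : ∀ i j → ι (i ℤ.+ j) ≈ ι i + ι j
  ι-+ (+ m)    (+ n)    = ιℕ-+ m n
  ι-+ (+ m)    -[1+ n ] = ι-⊖ m (suc n)
  ι-+ -[1+ m ] (+ n)    = trans (ι-⊖ n (suc m)) (+-comm _ _)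
  ι-+ -[1+ m ] -[1+ n ] = begin
    - ιℕ (suc (suc (m ℕ.+ n)))    ≡⟨ ≡.cong (λ k → - ιℕ (suc k)) (ℕₚ.+-suc m n) ⟨
    - ιℕ (suc m ℕ.+ suc n)        ≈⟨ -‿cong (ιℕ-+ (suc m) (suc n)) ⟩
    - (ιℕ (suc m) + ιℕ (suc n))   ≈⟨ ⁻¹-∙-comm _ _ ⟨
    - ιℕ (suc m) - ιℕ (suc n)     ∎

  ι-*-pos : ∀ m j → ι (+ m ℤ.* j) ≈ ιℕ m * ι j
  ι-*-pos m (+ n)    = trans (reflexive (≡.cong ι (≡.sym (ℤₚ.pos-* m n)))) (ιℕ-* m n)
  ι-*-pos m -[1+ n ] = begin
    ι (+ m ℤ.* -[1+ n ])       ≡⟨ ≡.cong ι (ℤₚ.neg-distribʳ-* (+ m) (+ suc n)) ⟨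
    ι (ℤ.- (+ m ℤ.* + suc n))  ≈⟨ ι-neg (+ m ℤ.* + suc n) ⟩
    - ι (+ m ℤ.* + suc n)      ≈⟨ -‿cong (ι-*-pos m (+ suc n)) ⟩
    - (ιℕ m * ιℕ (suc n))      ≈⟨ -‿distribʳ-* _ _ ⟩
    ιℕ m * - ιℕ (suc n)        ∎

  ι-* : ∀ i j → ι (i ℤ.* j) ≈ ι i * ι j
  ι-* (+ m)    j = ι-*-pos m j
  ι-* -[1+ m ] j = begin
    ι (-[1+ m ] ℤ.* j)         ≡⟨ ≡.cong ι (ℤₚ.neg-distribˡ-* (+ suc m) j) ⟨
    ι (ℤ.- (+ suc m ℤ.* j))    ≈⟨ ι-neg (+ suc m ℤ.* j) ⟩
    - ι (+ suc m ℤ.* j)        ≈⟨ -‿cong (ι-*-pos (suc m) j) ⟩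
    - (ιℕ (suc m) * ι j)       ≈⟨ -‿distribˡ-* _ _ ⟩
    - ιℕ (suc m) * ι j         ∎

  ι-1 : ι 1ℤ ≈ 1#
  ι-1 = +-identityʳ 1#

  ι-^ : ∀ i n → ι (i ℤ.^ n) ≈ ι i ^′ n
  ι-^ i zero    = ι-1
  ι-^ i (suc n) = trans (ι-* i (i ℤ.^ n)) (*-congˡ (ι-^ i n))

  open import Algebra.Solver.Ring.AlmostCommutativeRing using (fromCommutativeRing; _-Raw-AlmostCommutative⟶_)

  ι-homomorphism : ℤ.+-*-rawRing -Raw-AlmostCommutative⟶ fromCommutativeRing K
  ι-homomorphism = record
    { ⟦_⟧ = ι ; +-homo = ι-+ ; *-homo = ι-* ; -‿homo = ι-neg ; 0-homo = refl ; 1-homo = ι-1 }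

  ι-≟ : ∀ i j → Maybe (ι i ≈ ι j)
  ι-≟ i j with i ℤ.≟ j
  ... | yes ≡.refl = just refl
  ... | no  _      = nothing

  module Solver where
    open import Algebra.Solver.Ring ℤ.+-*-rawRing (fromCommutativeRing K) ι-homomorphism ι-≟ public
      using (solve; _:=_; _:+_; _:*_; :-_; _:-_; con)

  -- Integral means being the image of a rational integer, not being an algebraic integer.
  Integral : Carrier → Set ℓ
  Integral x = ∃ λ z → x ≈ ι z

  Integral-resp : ∀ {x y} → x ≈ y → Integral y → Integral x
  Integral-resp x≈y (z , y≈z) = z , trans x≈y y≈z

  Integral-0 : Integral 0#
  Integral-0 = 0ℤ , refl

  Integral-1 : Integral 1#
  Integral-1 = 1ℤ , sym ι-1

  Integral-+ : ∀ {x y} → Integral x → Integral y → Integral (x + y)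
  Integral-+ (i , p) (j , q) = i ℤ.+ j , trans (+-cong p q) (sym (ι-+ i j))

  Integral-* : ∀ {x y} → Integral x → Integral y → Integral (x * y)
  Integral-* (i , p) (j , q) = i ℤ.* j , trans (*-cong p q) (sym (ι-* i j))

  Integral-neg : ∀ {x} → Integral x → Integral (- x)
  Integral-neg (i , p) = ℤ.- i , trans (-‿cong p) (sym (ι-neg i))

  Integral-sub : ∀ {x y} → Integral x → Integral y → Integral (x - y)
  Integral-sub p q = Integral-+ p (Integral-neg q)

-- Exponent vectors of the monomials and lower bounds for their minima.

module Exponents where
  open import Data.Nat using (_+_; _*_; _^_; _⊔_)
  open ≡ using (refl; sym; trans; cong; cong₂; subst; subst₂)

  allFin-suc : ∀ k → allFin (suc k) ≡ zero ∷ map suc (allFin k)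
  allFin-suc k = cong (zero ∷_) (sym (map-tabulate id suc))

  open BigOperator ℕₚ.+-0-commutativeMonoid using ()
    renaming (big to Σℕ; big-cong to Σℕ-cong; big-map to Σℕ-map; big-∙ to Σℕ-+; big-concatMap-map to Σℕ-concatMap-map)

  Σℕ-mono : ∀ {xs : List A} {f g} → All (λ x → f x ≤ g x) xs → Σℕ xs f ≤ Σℕ xs g
  Σℕ-mono []       = z≤n
  Σℕ-mono (p ∷ ps) = ℕₚ.+-mono-≤ p (Σℕ-mono ps)

  Σℕ-*ˡ : ∀ c (xs : List A) f → Σℕ xs (λ x → c * f x) ≡ c * Σℕ xs f
  Σℕ-*ˡ c []       f = sym (ℕₚ.*-zeroʳ c)
  Σℕ-*ˡ c (x ∷ xs) f = trans (cong (c * f x +_) (Σℕ-*ˡ c xs f)) (sym (ℕₚ.*-distribˡ-+ c _ _))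

  Σℕ-*ʳ : ∀ c (xs : List A) f → Σℕ xs (λ x → f x * c) ≡ Σℕ xs f * c
  Σℕ-*ʳ c []       f = refl
  Σℕ-*ʳ c (x ∷ xs) f = trans (cong (f x * c +_) (Σℕ-*ʳ c xs f)) (sym (ℕₚ.*-distribʳ-+ c (f x) _))

  Σℕ-const : ∀ c (xs : List A) → Σℕ xs (λ _ → c) ≡ length xs * c
  Σℕ-const c []       = refl
  Σℕ-const c (x ∷ xs) = cong (c +_) (Σℕ-const c xs)

  length-allFin : ∀ k → length (allFin k) ≡ k
  length-allFin k = length-tabulate id

  Σℕ-allFin-suc : ∀ k (f : Fin (suc k) → ℕ) → Σℕ (allFin (suc k)) f ≡ f zero + Σℕ (allFin k) (f ∘ suc)
  Σℕ-allFin-suc k f = trans (cong (λ is → Σℕ is f) (allFin-suc k)) (cong (f zero +_) (Σℕ-map suc (allFin k) f))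

  -- Exactly one choice of j hits the entry i, so m enters once while the old entry is counted k
  -- times.
  Σℕ-updateAt : ∀ {k} m (u : Vector ℕ k) i → Σℕ (allFin k) (λ j → updateAt u j (m +_) i) ≡ m + k * u i
  Σℕ-updateAt {suc k} m u zero = trans (Σℕ-allFin-suc k _)
    (trans (cong (m + u zero +_) (trans (Σℕ-const (u zero) (allFin k)) (cong (_* u zero) (length-allFin k))))
      (ℕₚ.+-assoc m _ _))
  Σℕ-updateAt {suc k} m u (suc i) = trans (Σℕ-allFin-suc k _)
    (trans (cong (u (suc i) +_) (Σℕ-updateAt m (u ∘ suc) i)) (lem (u (suc i)) m (k * u (suc i))))
    where
    lem : ∀ x y z → x + (y + z) ≡ y + (x + z)
    lem = solve-∀

  updateAt-≤ : ∀ {k} m (u : Vector ℕ k) j i → updateAt u j (m +_) i ≤ m + u i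
  updateAt-≤ {suc k} m u zero    zero    = ℕₚ.≤-refl
  updateAt-≤ {suc k} m u zero    (suc i) = ℕₚ.m≤n+m _ m
  updateAt-≤ {suc k} m u (suc j) zero    = ℕₚ.m≤n+m _ m
  updateAt-≤ {suc k} m u (suc j) (suc i) = updateAt-≤ m (u ∘ suc) j i

  -- u v is the minimum times the maximum, and the maximum is at most o.
  m*n≤m⊓n*o : ∀ {u v o} → u ≤ o → v ≤ o → u * v ≤ (u ⊓ v) * o
  m*n≤m⊓n*o {u} {v} {o} u≤o v≤o with ℕₚ.≤-total u v
  ... | inj₁ u≤v = subst (λ x → u * v ≤ x * o) (sym (ℕₚ.m≤n⇒m⊓n≡m u≤v)) (ℕₚ.*-monoʳ-≤ u v≤o)
  ... | inj₂ v≤u = subst₂ (λ x y → x ≤ y * o) (ℕₚ.*-comm v u) (sym (ℕₚ.m≥n⇒m⊓n≡n v≤u)) (ℕₚ.*-monoʳ-≤ v u≤o)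

  m⊓n*m⊔n : ∀ m n → (m ⊓ n) * (m ⊔ n) ≡ m * n
  m⊓n*m⊔n m n with ℕₚ.≤-total m n
  ... | inj₁ m≤n rewrite ℕₚ.m≤n⇒m⊓n≡m m≤n | ℕₚ.m≤n⇒m⊔n≡n m≤n = refl
  ... | inj₂ n≤m rewrite ℕₚ.m≥n⇒m⊓n≡n n≤m | ℕₚ.m≥n⇒m⊔n≡m n≤m = ℕₚ.*-comm n m

  module _ (d : ℕ) where

    -- The exponent vectors of the monomials α_{j₁}^{m₁} ⋯ α_{j_r}^{m_r}, in the order of UDef.roots.
    exponents : List ℕ → List (Vector ℕ d)
    exponents []       = (λ _ → 0) ∷ []
    exponents (m ∷ ms) = concatMap (λ u → map (λ j → updateAt u j (m +_)) (allFin d)) (exponents ms)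

    Σℕ-exponents-∷ : ∀ m ms (f : Vector ℕ d → ℕ) →
      Σℕ (exponents (m ∷ ms)) f ≡ Σℕ (exponents ms) (λ u → Σℕ (allFin d) (λ j → f (updateAt u j (m +_))))
    Σℕ-exponents-∷ m ms f = Σℕ-concatMap-map (λ u j → updateAt u j (m +_)) (exponents ms) (allFin d) f

    length-exponents : ∀ ms → length (exponents ms) ≡ d ^ length ms
    length-exponents ms = trans (sym (trans (Σℕ-const 1 (exponents ms)) (ℕₚ.*-identityʳ _))) (count ms)
      where
      count : ∀ ms → Σℕ (exponents ms) (λ _ → 1) ≡ d ^ length ms
      count []       = refl
      count (m ∷ ms) = trans (Σℕ-exponents-∷ m ms (λ _ → 1))
        (trans (Σℕ-cong (exponents ms) (λ _ → trans (Σℕ-const 1 (allFin d)) (cong (_* 1) (length-allFin d))))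
          (trans (Σℕ-*ˡ d (exponents ms) (λ _ → 1)) (cong (d *_) (count ms))))

    -- By symmetry each variable receives on average the share 1/d of the total degree. The factor d
    -- stays on the left so that the empty list fits in without truncated subtraction.
    Σℕ-exponents : ∀ ms i → d * Σℕ (exponents ms) (λ u → u i) ≡ d ^ length ms * sum ms
    Σℕ-exponents []       i = ℕₚ.*-zeroʳ d
    Σℕ-exponents (m ∷ ms) i = begin
      d * Σℕ (exponents (m ∷ ms)) (λ u → u i)                     ≡⟨ cong (d *_) (Σℕ-exponents-∷ m ms (λ u → u i)) ⟩
      d * Σℕ (exponents ms) (λ u → Σℕ (allFin d) (λ j → updateAt u j (m +_) i))
                                                                  ≡⟨ cong (d *_) (Σℕ-cong (exponents ms) (λ u → Σℕ-updateAt m u i)) ⟩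
      d * Σℕ (exponents ms) (λ u → m + d * u i)                   ≡⟨ cong (d *_) (Σℕ-+ (exponents ms) (λ _ → m) (λ u → d * u i)) ⟩
      d * (Σℕ (exponents ms) (λ _ → m) + Σℕ (exponents ms) (λ u → d * u i))
        ≡⟨ cong (d *_) (cong₂ _+_ (trans (Σℕ-const m (exponents ms)) (cong (_* m) (length-exponents ms)))
                                 (trans (Σℕ-*ˡ d (exponents ms) (λ u → u i)) (Σℕ-exponents ms i))) ⟩
      d * (d ^ length ms * m + d ^ length ms * sum ms)            ≡⟨ lem d (d ^ length ms) m (sum ms) ⟩
      d * d ^ length ms * (m + sum ms)                            ∎
      where
      open ≡.≡-Reasoning
      lem : ∀ d x m s → d * (x * m + x * s) ≡ d * x * (m + s)
      lem = solve-∀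

    exponents-≤ : ∀ ms i → All (λ u → u i ≤ sum ms) (exponents ms)
    exponents-≤ []       i = z≤n ∷ []
    exponents-≤ (m ∷ ms) i = Allₚ.concat⁺ (Allₚ.map⁺ (All.map
      (λ {u} u≤ → Allₚ.map⁺ (All.universal (λ j → ℕₚ.≤-trans (updateAt-≤ m u j i) (ℕₚ.+-monoʳ-≤ m u≤)) (allFin d)))
      (exponents-≤ ms i)))

    minExponent : List ℕ → List ℕ → Vector ℕ d
    minExponent ms ns i = Σℕ (exponents ms) (λ u → Σℕ (exponents ns) (λ v → u i ⊓ v i))

    -- min(u,v) ≥ uv / max(Σms, Σns), and the sum of uv over all index choices factorises.
    minExponent-lower : ∀ ms ns i →
      d ^ (length ms + length ns) * (sum ms ⊓ sum ns) * (sum ms ⊔ sum ns) ≤ d * d * minExponent ms ns i * (sum ms ⊔ sum ns)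
    minExponent-lower ms ns i = begin
      d ^ (length ms + length ns) * (X ⊓ Y) * (X ⊔ Y)        ≡⟨ ℕₚ.*-assoc (d ^ (length ms + length ns)) _ _ ⟩
      d ^ (length ms + length ns) * ((X ⊓ Y) * (X ⊔ Y))      ≡⟨ cong₂ _*_ (ℕₚ.^-distribˡ-+-* d (length ms) _) (m⊓n*m⊔n X Y) ⟩
      d ^ length ms * d ^ length ns * (X * Y)                ≡⟨ lem₁ (d ^ length ms) (d ^ length ns) X Y ⟩
      d ^ length ms * X * (d ^ length ns * Y)                ≡⟨ cong₂ _*_ (Σℕ-exponents ms i) (Σℕ-exponents ns i) ⟨
      d * S * (d * T)                                        ≡⟨ lem₁ d S d T ⟩
      d * d * (S * T)                                        ≡⟨ cong (d * d *_) (Σℕ-*ʳ T (exponents ms) (λ u → u i)) ⟨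
      d * d * Σℕ (exponents ms) (λ u → u i * T)              ≡⟨ cong (d * d *_) (Σℕ-cong (exponents ms) (λ u → Σℕ-*ˡ (u i) (exponents ns) (λ v → v i))) ⟨
      d * d * Σℕ (exponents ms) (λ u → Σℕ (exponents ns) (λ v → u i * v i))
        ≤⟨ ℕₚ.*-monoʳ-≤ (d * d) (Σℕ-mono (All.map (λ u≤ → Σℕ-mono (All.map (λ v≤ →
             m*n≤m⊓n*o (ℕₚ.≤-trans u≤ (ℕₚ.m≤m⊔n X Y)) (ℕₚ.≤-trans v≤ (ℕₚ.m≤n⊔m X Y))) (exponents-≤ ns i))) (exponents-≤ ms i))) ⟩
      d * d * Σℕ (exponents ms) (λ u → Σℕ (exponents ns) (λ v → (u i ⊓ v i) * (X ⊔ Y)))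
        ≡⟨ cong (d * d *_) (Σℕ-cong (exponents ms) (λ u → Σℕ-*ʳ (X ⊔ Y) (exponents ns) (λ v → u i ⊓ v i))) ⟩
      d * d * Σℕ (exponents ms) (λ u → Σℕ (exponents ns) (λ v → u i ⊓ v i) * (X ⊔ Y))
        ≡⟨ cong (d * d *_) (Σℕ-*ʳ (X ⊔ Y) (exponents ms) _) ⟩
      d * d * (minExponent ms ns i * (X ⊔ Y))                ≡⟨ ℕₚ.*-assoc (d * d) _ _ ⟨
      d * d * minExponent ms ns i * (X ⊔ Y)                  ∎
      where
      open ℕₚ.≤-Reasoning
      X = sum ms
      Y = sum ns
      S = Σℕ (exponents ms) (λ u → u i)
      T = Σℕ (exponents ns) (λ u → u i)
      lem₁ : ∀ a b x y → a * b * (x * y) ≡ a * x * (b * y)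
      lem₁ = solve-∀

    minExponent-≥ : ∀ {l w} ms ns → 2 ≤ l → l ≤ length ms + length ns → w ≤ sum ms → w ≤ sum ns →
      ∀ i → w * d ^ (l ∸ 2) ≤ minExponent ms ns i
    -- The case w = 0 is separated because otherwise the maximum of the two sums, which is cancelled
    -- below, could vanish.
    minExponent-≥ {l} {zero}  ms ns _ _ _ _ i = z≤n
    minExponent-≥ {l} {w@(suc _)} ms ns 2≤l l≤ w≤X w≤Y i =
      ℕₚ.*-cancelˡ-≤ (d * d) {{ℕₚ.m*n≢0 d d}} (ℕₚ.*-cancelʳ-≤ _ _ (X ⊔ Y) {{max≢0}} (begin
        d * d * (w * d ^ (l ∸ 2)) * (X ⊔ Y)        ≡⟨ cong (_* (X ⊔ Y)) (lem d w (d ^ (l ∸ 2))) ⟩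
        d ^ (2 + (l ∸ 2)) * w * (X ⊔ Y)            ≡⟨ cong (λ k → d ^ k * w * (X ⊔ Y)) (ℕₚ.m+[n∸m]≡n 2≤l) ⟩
        d ^ l * w * (X ⊔ Y)                        ≤⟨ ℕₚ.*-monoˡ-≤ (X ⊔ Y) (ℕₚ.*-mono-≤ (ℕₚ.^-monoʳ-≤ d l≤) (ℕₚ.⊓-glb w≤X w≤Y)) ⟩
        d ^ (length ms + length ns) * (X ⊓ Y) * (X ⊔ Y) ≤⟨ minExponent-lower ms ns i ⟩
        d * d * minExponent ms ns i * (X ⊔ Y)      ∎))
      where
      open ℕₚ.≤-Reasoning
      X = sum ms
      Y = sum ns
      instance
        d≢0 : NonZero d
        d≢0 = nonZeroIndex i
      max≢0 : NonZero (X ⊔ Y)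
      max≢0 = ℕ.>-nonZero (ℕₚ.≤-trans (s≤s z≤n) (ℕₚ.≤-trans w≤X (ℕₚ.m≤m⊔n X Y)))
      lem : ∀ d w x → d * d * (w * x) ≡ d * (d * x) * w
      lem = solve-∀

open Exponents

-- Newton's identities and integrality of power sums.

module Newton {c ℓ} (K : CommutativeRing c ℓ) where
  open CommutativeRing K
  open import Data.Integer using (+_)
  open Poly K
  open Integers K
  open Solver
  open BigOperator +-commutativeMonoid
  open import Relation.Binary.Reasoning.Setoid setoid

  -- The linear functional that sends the i-th power of X to `s i`. Multiplication by X becomes a
  -- shift of `s`, so linear recurrences and Newton's identities are statements about one and the
  -- same pairing.
  pair : Pol → (ℕ → Carrier) → Carrier
  pair []      s = 0#
  pair (a ∷ f) s = a * s 0 + pair f (s ∘ suc)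

  pair-zero : ∀ f s → (∀ i → coeff f i ≈ 0#) → pair f s ≈ 0#
  pair-zero []      s h = refl
  pair-zero (a ∷ f) s h = begin
    a * s 0 + pair f (s ∘ suc)  ≈⟨ +-cong (*-congʳ (h 0)) (pair-zero f (s ∘ suc) (h ∘ suc)) ⟩
    0# * s 0 + 0#               ≈⟨ solve 1 (λ x → con 0ℤ :* x :+ con 0ℤ := con 0ℤ) refl (s 0) ⟩
    0#                          ∎

  pair-congˡ : ∀ f g s → f ≈ₚ g → pair f s ≈ pair g s
  pair-congˡ []      g       s h = sym (pair-zero g s (sym ∘ h))
  pair-congˡ (a ∷ f) []      s h = pair-zero (a ∷ f) s h
  pair-congˡ (a ∷ f) (b ∷ g) s h = +-cong (*-congʳ (h 0)) (pair-congˡ f g (s ∘ suc) (h ∘ suc))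

  pair-congʳ : ∀ f {s t} → (∀ n → s n ≈ t n) → pair f s ≈ pair f t
  pair-congʳ []      h = refl
  pair-congʳ (a ∷ f) h = +-cong (*-congˡ (h 0)) (pair-congʳ f (h ∘ suc))

  pair-+ₚ : ∀ f g s → pair (f +ₚ g) s ≈ pair f s + pair g s
  pair-+ₚ []      g       s = sym (+-identityˡ _)
  pair-+ₚ (a ∷ f) []      s = sym (+-identityʳ _)
  pair-+ₚ (a ∷ f) (b ∷ g) s = trans (+-congˡ (pair-+ₚ f g (s ∘ suc)))
    (solve 5 (λ a b x y z → (a :+ b) :* x :+ (y :+ z) := (a :* x :+ y) :+ (b :* x :+ z)) refl a b (s 0) _ _)

  pair-scaleˡ : ∀ x f s → pair (map (x *_) f) s ≈ x * pair f s
  pair-scaleˡ x []      s = sym (zeroʳ x)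
  pair-scaleˡ x (a ∷ f) s = trans (+-congˡ (pair-scaleˡ x f (s ∘ suc)))
    (solve 4 (λ x a y z → x :* a :* y :+ x :* z := x :* (a :* y :+ z)) refl x a (s 0) _)

  pair-+ʳ : ∀ f s t → pair f (λ n → s n + t n) ≈ pair f s + pair f t
  pair-+ʳ []      s t = sym (+-identityˡ 0#)
  pair-+ʳ (a ∷ f) s t = trans (+-congˡ (pair-+ʳ f (s ∘ suc) (t ∘ suc)))
    (solve 5 (λ a x y z w → a :* (x :+ y) :+ (z :+ w) := (a :* x :+ z) :+ (a :* y :+ w)) refl a (s 0) (t 0) _ _)

  pair-shift : ∀ f x s → pair f (λ n → s (suc n) - x * s n) ≈ pair f (s ∘ suc) - x * pair f s
  pair-shift []      x s = solve 1 (λ x → con 0ℤ := con 0ℤ :- x :* con 0ℤ) refl x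
  pair-shift (a ∷ f) x s = trans (+-congˡ (pair-shift f x (s ∘ suc)))
    (solve 6 (λ a x y z u v → a :* (z :- x :* y) :+ (u :- x :* v) := (a :* z :+ u) :- x :* (a :* y :+ v))
      refl a x (s 0) (s 1) _ _)

  -- Multiplication by X - x is adjoint to the operator sending s to its shift minus x s. With
  -- `pair-shift` this moves a linear factor from the polynomial to the sequence, so roots can be
  -- removed one at a time.
  pair-X- : ∀ x f s → pair ((X- x) *ₚ f) s ≈ pair f (s ∘ suc) - x * pair f s
  pair-X- x f s = begin
    pair (map (- x *_) f +ₚ (0# ∷ f′)) s                ≈⟨ pair-+ₚ (map (- x *_) f) (0# ∷ f′) s ⟩
    pair (map (- x *_) f) s + (0# * s 0 + pair f′ t)    ≈⟨ +-cong (pair-scaleˡ (- x) f s) (+-congˡ (trans (pair-+ₚ (map (1# *_) f) (0# ∷ []) t) (+-congʳ (pair-scaleˡ 1# f t)))) ⟩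
    - x * pair f s + (0# * s 0 + (1# * pair f t + (0# * t 0 + 0#))) ≈⟨ +-congˡ (+-congˡ (+-congʳ (*-identityˡ _))) ⟩
    - x * pair f s + (0# * s 0 + (pair f t + (0# * t 0 + 0#)))
      ≈⟨ solve 5 (λ x y z u v → (:- x) :* y :+ (con 0ℤ :* u :+ (z :+ (con 0ℤ :* v :+ con 0ℤ))) := z :- x :* y) refl x _ _ (s 0) (t 0) ⟩
    pair f t - x * pair f s                             ∎
    where
    t  = s ∘ suc
    f′ = map (1# *_) f +ₚ (0# ∷ [])

  -- The Kronecker delta: it turns coefficients into pairings, so that `pair-X-` also yields the
  -- coefficients of a product with X - x.
  δ : ℕ → ℕ → Carrier
  δ zero    zero    = 1#
  δ zero    (suc n) = 0#
  δ (suc k) zero    = 0#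
  δ (suc k) (suc n) = δ k n

  pair-0 : ∀ f → pair f (λ _ → 0#) ≈ 0#
  pair-0 []      = refl
  pair-0 (a ∷ f) = trans (+-cong (zeroʳ a) (pair-0 f)) (+-identityˡ 0#)

  pair-δ : ∀ f k → pair f (δ k) ≈ coeff f k
  pair-δ []      k       = refl
  pair-δ (a ∷ f) zero    = trans (+-cong (*-identityʳ a) (pair-0 f)) (+-identityʳ a)
  pair-δ (a ∷ f) (suc k) = trans (+-cong (zeroʳ a) (pair-δ f k)) (+-identityˡ _)

  coeff-X-zero : ∀ x f → coeff ((X- x) *ₚ f) 0 ≈ - x * coeff f 0
  coeff-X-zero x f = begin
    coeff ((X- x) *ₚ f) 0               ≈⟨ pair-δ ((X- x) *ₚ f) 0 ⟨
    pair ((X- x) *ₚ f) (δ 0)            ≈⟨ pair-X- x f (δ 0) ⟩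
    pair f (λ _ → 0#) - x * pair f (δ 0) ≈⟨ +-cong (pair-0 f) (-‿cong (*-congˡ (pair-δ f 0))) ⟩
    0# - x * coeff f 0                  ≈⟨ solve 2 (λ x y → con 0ℤ :- x :* y := (:- x) :* y) refl x _ ⟩
    - x * coeff f 0                     ∎

  coeff-X-suc : ∀ x f k → coeff ((X- x) *ₚ f) (suc k) ≈ coeff f k - x * coeff f (suc k)
  coeff-X-suc x f k = begin
    coeff ((X- x) *ₚ f) (suc k)              ≈⟨ pair-δ ((X- x) *ₚ f) (suc k) ⟨
    pair ((X- x) *ₚ f) (δ (suc k))           ≈⟨ pair-X- x f (δ (suc k)) ⟩
    pair f (δ k) - x * pair f (δ (suc k))    ≈⟨ +-cong (pair-δ f k) (-‿cong (*-congˡ (pair-δ f (suc k)))) ⟩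
    coeff f k - x * coeff f (suc k)          ∎

  fromRoots : List Carrier → Pol
  fromRoots as = prodₚ (map X-_ as)

  -- The sign is (-1)^d. It is recorded through s s = 1, which is what solving for the product of
  -- the roots requires.
  coeff₀-fromRoots : ∀ as → ∃ λ s → s ℤ.* s ≡ 1ℤ × coeff (fromRoots as) 0 ≈ ι s * prodR as
  coeff₀-fromRoots [] = 1ℤ , ≡.refl , sym (trans (*-identityʳ _) ι-1)
  coeff₀-fromRoots (a ∷ as) with s , ss≡1 , eq ← coeff₀-fromRoots as =
    ℤ.- s , ≡.trans neg*neg ss≡1 , (begin
      coeff (fromRoots (a ∷ as)) 0   ≈⟨ coeff-X-zero a (fromRoots as) ⟩
      - a * coeff (fromRoots as) 0   ≈⟨ *-congˡ eq ⟩
      - a * (ι s * prodR as)         ≈⟨ solve 3 (λ a s p → (:- a) :* (s :* p) := (:- s) :* (a :* p)) refl a (ι s) (prodR as) ⟩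
      - ι s * (a * prodR as)         ≈⟨ *-congʳ (ι-neg s) ⟨
      ι (ℤ.- s) * (a * prodR as)     ∎)
    where
    neg*neg : ℤ.- s ℤ.* ℤ.- s ≡ s ℤ.* s
    neg*neg = ≡.trans (≡.sym (ℤₚ.neg-distribˡ-* s (ℤ.- s))) (≡.trans (≡.cong ℤ.-_ (≡.sym (ℤₚ.neg-distribʳ-* s s))) (ℤₚ.neg-involutive _))

  powerSum : List Carrier → ℕ → Carrier
  powerSum as n = big as (_^′ n)

  -- The sequence delayed by k zeros: pairing with it sums the coefficients from index k on against
  -- s 0, s 1, and so on, as in Newton's identities.
  pad : ℕ → (ℕ → Carrier) → ℕ → Carrier
  pad zero    s n       = s n
  pad (suc k) s zero    = 0#
  pad (suc k) s (suc n) = pad k s n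

  -- The powers of a root satisfy the recurrence given by the polynomial. In the induction the
  -- operator of X - a kills the powers of the new root a, and the other roots remain.
  pair-powerSum : ∀ as m → pair (fromRoots as) (λ n → powerSum as (n ℕ.+ m)) ≈ 0#
  pair-powerSum []       m = pair-0 (const 1#)
  pair-powerSum (a ∷ as) m = begin
    pair (fromRoots (a ∷ as)) P                      ≈⟨ pair-X- a f P ⟩
    pair f (P ∘ suc) - a * pair f P                  ≈⟨ pair-shift f a P ⟨
    pair f (λ n → P (suc n) - a * P n)               ≈⟨ pair-congʳ f (λ n → solve 4 (λ a x y z → a :* x :+ y :- a :* (x :+ z) := y :- a :* z) refl a (a ^′ (n ℕ.+ m)) _ _) ⟩
    pair f (λ n → p (suc n) - a * p n)               ≈⟨ pair-shift f a p ⟩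
    pair f (p ∘ suc) - a * pair f p                  ≈⟨ +-cong (trans (pair-congʳ f λ n → reflexive (≡.cong (powerSum as) (≡.sym (ℕₚ.+-suc n m)))) (pair-powerSum as (suc m))) (-‿cong (*-congˡ (pair-powerSum as m))) ⟩
    0# - a * 0#                                      ≈⟨ solve 1 (λ a → con 0ℤ :- a :* con 0ℤ := con 0ℤ) refl a ⟩
    0#                                               ∎
    where
    f = fromRoots as
    P = λ n → powerSum (a ∷ as) (n ℕ.+ m)
    p = λ n → powerSum as (n ℕ.+ m)

  -- Comparison of coefficients in X f′ = f · Σ p_j X^(-j), where p_j are the power sums. The factor
  -- k arises in the induction over the roots, each of which contributes through `δ k`.
  newton : ∀ as k → pair (fromRoots as) (pad k (powerSum as)) ≈ ιℕ k * coeff (fromRoots as) k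
  newton as zero = begin
    pair (fromRoots as) (powerSum as)  ≈⟨ pair-congʳ (fromRoots as) (λ n → reflexive (≡.cong (powerSum as) (≡.sym (ℕₚ.+-identityʳ n)))) ⟩
    _                                  ≈⟨ pair-powerSum as 0 ⟩
    0#                                 ≈⟨ zeroˡ _ ⟨
    0# * coeff (fromRoots as) 0        ∎
  newton [] (suc k) = solve 2 (λ u x → u :* con 0ℤ :+ con 0ℤ := x :* con 0ℤ) refl 1# (ιℕ (suc k))
  newton (a ∷ as) (suc k) = begin
    pair (fromRoots (a ∷ as)) (pad (suc k) P)                          ≈⟨ pair-X- a f (pad (suc k) P) ⟩
    pair f (pad k P) - a * pair f (pad (suc k) P)                      ≈⟨ pair-shift f a (pad (suc k) P) ⟨
    pair f (λ n → pad k P n - a * pad (suc k) P n)                     ≈⟨ pair-congʳ f (pointwise k) ⟩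
    pair f (λ n → (pad k p n - a * pad (suc k) p n) + δ k n)           ≈⟨ pair-+ʳ f _ (δ k) ⟩
    pair f (λ n → pad k p n - a * pad (suc k) p n) + pair f (δ k)      ≈⟨ +-cong (pair-shift f a (pad (suc k) p)) (pair-δ f k) ⟩
    (pair f (pad k p) - a * pair f (pad (suc k) p)) + coeff f k        ≈⟨ +-congʳ (+-cong (newton as k) (-‿cong (*-congˡ (newton as (suc k))))) ⟩
    (ιℕ k * coeff f k - a * ((1# + ιℕ k) * coeff f (suc k))) + coeff f k
      ≈⟨ +-congʳ (+-congˡ (-‿cong (*-congˡ (*-congʳ (+-congʳ ι-1))))) ⟨
    (ιℕ k * coeff f k - a * ((ι 1ℤ + ιℕ k) * coeff f (suc k))) + coeff f k
      ≈⟨ solve 4 (λ a i x y → (i :* x :- a :* ((con 1ℤ :+ i) :* y)) :+ x := (con 1ℤ :+ i) :* (x :- a :* y)) refl a (ιℕ k) _ _ ⟩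
    (ι 1ℤ + ιℕ k) * (coeff f k - a * coeff f (suc k))
      ≈⟨ *-cong (+-congʳ ι-1) (sym (coeff-X-suc a f k)) ⟩
    ιℕ (suc k) * coeff (fromRoots (a ∷ as)) (suc k)                    ∎
    where
    f = fromRoots as
    P = powerSum (a ∷ as)
    p = powerSum as
    -- The powers of the new root a, delayed by k, minus a times the same delayed by k + 1,
    -- telescope to a single 1 at position k.
    pointwise : ∀ k n → pad k P n - a * pad (suc k) P n ≈ (pad k p n - a * pad (suc k) p n) + δ k n
    pointwise zero    zero    = solve 3 (λ a u x → u :+ x :- a :* con 0ℤ := (x :- a :* con 0ℤ) :+ u) refl a 1# _
    pointwise zero    (suc n) = solve 4 (λ a x y z → a :* x :+ y :- a :* (x :+ z) := (y :- a :* z) :+ con 0ℤ) refl a (a ^′ n) _ _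
    pointwise (suc k) zero    = sym (+-identityʳ _)
    pointwise (suc k) (suc n) = pointwise k n

  coeff-map-ι : ∀ zs k → Integral (coeff (map ι zs) k)
  coeff-map-ι []       k       = Integral-0
  coeff-map-ι (z ∷ zs) zero    = z , refl
  coeff-map-ι (z ∷ zs) (suc k) = coeff-map-ι zs k

  -- The polynomial is monic, so the top term is the pairing minus integer multiples of the lower
  -- terms.
  leading-Integral : ∀ zs t → (∀ k → k < length zs → Integral (t k)) →
    Integral (pair (map ι (zs ++ 1ℤ ∷ [])) t) → Integral (t (length zs))
  leading-Integral [] t _ int = Integral-resp
    (solve 1 (λ x → x := con 1ℤ :* x :+ con 0ℤ) refl (t 0)) int
  leading-Integral (z ∷ zs) t below int = leading-Integral zs (t ∘ suc) (λ k k< → below (suc k) (s≤s k<))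
    (Integral-resp (solve 2 (λ x y → y := (x :+ y) :- x) refl (ι z * t 0) _)
      (Integral-sub int (Integral-* (z , refl) (below 0 (s≤s z≤n)))))

  -- Prefix the power sums with d zeros, d being the degree. Every shift of this sequence pairs with
  -- P to an integer: a shift by m < d gives (d - m) times a coefficient by Newton, and from m = d
  -- on the pairing is 0. Since P is monic, integrality spreads from the initial zeros to all later
  -- entries.
  powerSum-Integral : ∀ zs as → map ι (zs ++ 1ℤ ∷ []) ≈ₚ fromRoots as → ∀ n → Integral (powerSum as n)
  powerSum-Integral zs as zs≈ n = Integral-resp (reflexive (≡.sym (≡.trans (≡.cong s (ℕₚ.+-comm n d)) (pad-+ d n))))
    (leading-Integral zs (λ k → s (n ℕ.+ k)) (window n) (pairs d n))
    where
    d = length zs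
    p = powerSum as
    s = pad d p
    f = map ι (zs ++ 1ℤ ∷ [])
    pad-+ : ∀ d n → pad d p (d ℕ.+ n) ≡ p n
    pad-+ zero    n = ≡.refl
    pad-+ (suc d) n = pad-+ d n
    pad-< : ∀ d k → k < d → pad d p k ≡ 0#
    pad-< (suc d) zero    _         = ≡.refl
    pad-< (suc d) (suc k) (s≤s k<d) = pad-< d k k<d
    pairs : ∀ d m → Integral (pair f (λ k → pad d p (m ℕ.+ k)))
    pairs zero m = Integral-resp (begin
      pair f (λ k → p (m ℕ.+ k))              ≈⟨ pair-congˡ f (fromRoots as) _ zs≈ ⟩
      pair (fromRoots as) (λ k → p (m ℕ.+ k)) ≈⟨ pair-congʳ (fromRoots as) (λ k → reflexive (≡.cong p (ℕₚ.+-comm m k))) ⟩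
      pair (fromRoots as) (λ k → p (k ℕ.+ m)) ≈⟨ pair-powerSum as m ⟩
      0#                                      ∎) Integral-0
    pairs (suc d) zero = Integral-resp (begin
      pair f (pad (suc d) p)                  ≈⟨ pair-congˡ f (fromRoots as) _ zs≈ ⟩
      pair (fromRoots as) (pad (suc d) p)     ≈⟨ newton as (suc d) ⟩
      ιℕ (suc d) * coeff (fromRoots as) (suc d) ≈⟨ *-congˡ (zs≈ (suc d)) ⟨
      ιℕ (suc d) * coeff f (suc d)            ∎) (Integral-* (+ suc d , refl) (coeff-map-ι (zs ++ 1ℤ ∷ []) (suc d)))
    pairs (suc d) (suc m) = pairs d m
    window : ∀ m k → k < d → Integral (s (m ℕ.+ k))
    window zero    k k<d = Integral-resp (reflexive (pad-< d k k<d)) Integral-0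
    -- Moving the window by one brings in a single new entry, the leading term of the previous
    -- pairing.
    window (suc m) k k<d with ℕₚ.m≤n⇒m<n∨m≡n k<d
    ... | inj₁ 1+k<d = ≡.subst (Integral ∘ s) (ℕₚ.+-suc m k) (window m (suc k) 1+k<d)
    ... | inj₂ 1+k≡d = ≡.subst (Integral ∘ s) (≡.trans (≡.cong (m ℕ.+_) (≡.sym 1+k≡d)) (ℕₚ.+-suc m k))
                         (leading-Integral zs (λ k → s (m ℕ.+ k)) (window m) (pairs d m))

-- Ordered choices of entries from a list.

picks : List A → List (A × List A)
picks []       = []
picks (x ∷ xs) = (x , xs) ∷ map (λ (y , ys) → y , x ∷ ys) (picks xs)

picks-↭ : (xs : List A) → All (λ (y , ys) → y ∷ ys ↭ xs) (picks xs)
picks-↭ []       = []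
picks-↭ (x ∷ xs) = ↭-refl ∷ Allₚ.map⁺ (All.map (λ p → ↭-trans (swap _ _ ↭-refl) (prep x p)) (picks-↭ xs))

-- The ways of choosing k entries of a list one after another, each with the list of entries left over.
arrangements : (k : ℕ) → List A → List (Vector A k × List A)
arrangements zero    xs = (⟨⟩ , xs) ∷ []
arrangements (suc k) xs = concatMap (λ (v , ys) → map (λ (z , zs) → z ◂ v , zs) (picks ys)) (arrangements k xs)

arrangements-↭ : ∀ k (xs : List A) → All (λ (v , ys) → tabulate v ++ ys ↭ xs) (arrangements k xs)
arrangements-↭ zero    xs = ↭-refl ∷ []
arrangements-↭ (suc k) xs = Allₚ.concat⁺ (Allₚ.map⁺ (All.map
  (λ {(v , ys)} p → Allₚ.map⁺ (All.map
    (λ {(z , zs)} q → ↭-trans (↭-sym (↭.shift z (tabulate v) zs)) (↭-trans (↭.++⁺ˡ (tabulate v) q) p))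
    (picks-↭ ys)))
  (arrangements-↭ k xs)))

-- Choosing as many entries as there are leaves nothing over, so these are the orderings of the
-- list.
arrangements-full : ∀ {k} (xs : List A) → length xs ≡ k → All (λ (v , _) → tabulate v ↭ xs) (arrangements k xs)
arrangements-full {k = k} xs |xs|≡k = All.map
  (λ {(v , ys)} p → ≡.subst (_↭ xs) (full v ys (≡.trans (↭.↭-length p) |xs|≡k)) p) (arrangements-↭ k xs)
  where
  full : ∀ v ys → length (tabulate v ++ ys) ≡ k → tabulate v ++ ys ≡ tabulate v
  full v []       _  = ++-identityʳ _
  full v (y ∷ ys) eq = contradiction
    (ℕₚ.+-cancelˡ-≡ k (suc (length ys)) 0 (≡.trans (≡.cong (ℕ._+ suc (length ys)) (≡.sym (length-tabulate v)))
      (≡.trans (≡.sym (length-++ (tabulate v))) (≡.trans eq (≡.sym (ℕₚ.+-identityʳ k))))))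
    (λ ())

concatMap-nonempty : ∀ (h : A → List B) xs → 0 < length xs → All (λ x → 0 < length (h x)) xs → 0 < length (concatMap h xs)
concatMap-nonempty h (x ∷ xs) _ (hx>0 ∷ _) = ≡.subst (0 <_) (≡.sym (length-++ (h x))) (ℕₚ.<-≤-trans hx>0 (ℕₚ.m≤m+n _ _))

-- Makes the denominator in `invariant-Integral` nonzero; for k = `length xs` it is the factorial of
-- k.
arrangements-nonempty : ∀ k (xs : List A) → k ≤ length xs → 0 < length (arrangements k xs)
arrangements-nonempty zero    xs _    = s≤s z≤n
arrangements-nonempty (suc k) xs k<∣xs∣ = concatMap-nonempty _ (arrangements k xs)
  (arrangements-nonempty k xs (ℕₚ.<⇒≤ k<∣xs∣))
  (All.map (λ {(v , ys)} p → ≡.subst (0 <_) (≡.sym (length-map _ (picks ys))) (pick>0 v ys (↭.↭-length p))) (arrangements-↭ k xs))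
  where
  pick>0 : ∀ (v : Vector _ k) ys → length (tabulate v ++ ys) ≡ length xs → 0 < length (picks ys)
  pick>0 v (_ ∷ _) _  = s≤s z≤n
  pick>0 v []      eq = contradiction
    (≡.trans (≡.sym (length-tabulate v)) (≡.trans (≡.cong length (≡.sym (++-identityʳ (tabulate v)))) eq))
    (ℕₚ.<⇒≢ k<∣xs∣)

abs-^ : ∀ i n → ℤ.∣ i ℤ.^ n ∣ ≡ ℤ.∣ i ∣ ℕ.^ n
abs-^ i zero    = ≡.refl
abs-^ i (suc n) = ≡.trans (ℤₚ.abs-* i (i ℤ.^ n)) (≡.cong (ℤ.∣ i ∣ ℕ.*_) (abs-^ i n))

-- Sums over all orderings of the roots, and descent to the integers.

module Symmetric {c ℓ} (K : CommutativeRing c ℓ) where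
  open import Data.Integer using (+_)
  open CommutativeRing K hiding (zero)
  open Poly K
  open Integers K
  open Solver
  open Newton K using (powerSum)
  open BigOperator +-commutativeMonoid public using () renaming
    (big to Σ; big-cong to Σ-cong; big-cong-All to Σ-cong-All; big-∙ to Σ-+; big-map to Σ-map
    ; big-concatMap-map to Σ-concatMap-map; big-↭ to Σ-↭; big-++ to Σ-++; big-swap to Σ-swap)
  open BigOperator *-commutativeMonoid public using () renaming
    (big to Π; big-cong to Π-cong; big-∙ to Π-*; big-ε to Π-1; big-map to Π-map; big-concatMap-map to Π-concatMap-map; big-↭ to Π-↭)
  open import Relation.Binary.Reasoning.Setoid setoid

  Σ-*ˡ : ∀ x (xs : List A) f → Σ xs (λ i → x * f i) ≈ x * Σ xs f
  Σ-*ˡ x []       f = sym (zeroʳ x)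
  Σ-*ˡ x (_ ∷ xs) f = trans (+-congˡ (Σ-*ˡ x xs f)) (sym (distribˡ x _ _))

  Σ-*ʳ : ∀ x (xs : List A) f → Σ xs (λ i → f i * x) ≈ Σ xs f * x
  Σ-*ʳ x xs f = trans (Σ-cong xs (λ i → *-comm _ x)) (trans (Σ-*ˡ x xs f) (*-comm x _))

  Σ-sub : ∀ (xs : List A) f g → Σ xs (λ i → f i - g i) ≈ Σ xs f - Σ xs g
  Σ-sub []       f g = sym (-‿inverseʳ 0#)
  Σ-sub (x ∷ xs) f g = trans (+-congˡ (Σ-sub xs f g))
    (solve 4 (λ a b c d → (a :- b) :+ (c :- d) := (a :+ c) :- (b :+ d)) refl (f x) (g x) _ _)

  Σ-const : ∀ x (xs : List A) → Σ xs (λ _ → x) ≈ ιℕ (length xs) * x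
  Σ-const x []       = sym (zeroˡ x)
  Σ-const x (_ ∷ xs) = trans (+-cong (sym (*-identityˡ x)) (Σ-const x xs)) (sym (distribʳ x 1# _))

  Σ-Integral : ∀ (xs : List A) f → (∀ i → Integral (f i)) → Integral (Σ xs f)
  Σ-Integral []       f h = Integral-0
  Σ-Integral (x ∷ xs) f h = Integral-+ (h x) (Σ-Integral xs f h)

  Σ-picks : ∀ (xs : List A) (f : A → Carrier) → Σ (picks xs) (f ∘ proj₁) ≈ Σ xs f
  Σ-picks []       f = refl
  Σ-picks (x ∷ xs) f = +-congˡ (trans (reflexive (Σ-map _ (picks xs) (f ∘ proj₁))) (Σ-picks xs f))

  ^-+ : ∀ x m n → x ^′ (m ℕ.+ n) ≈ x ^′ m * x ^′ n
  ^-+ x zero    n = sym (*-identityˡ _)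
  ^-+ x (suc m) n = trans (*-congˡ (^-+ x m n)) (sym (*-assoc x _ _))

  ^-*-distrib : ∀ x y n → (x * y) ^′ n ≈ x ^′ n * y ^′ n
  ^-*-distrib x y zero    = sym (*-identityˡ 1#)
  ^-*-distrib x y (suc n) = trans (*-congˡ (^-*-distrib x y n))
    (solve 4 (λ a b c d → a :* b :* (c :* d) := a :* c :* (b :* d)) refl x y _ _)

  ^-cong : ∀ {x y} n → x ≈ y → x ^′ n ≈ y ^′ n
  ^-cong zero    x≈y = refl
  ^-cong (suc n) x≈y = *-cong x≈y (^-cong n x≈y)

  monomial : ∀ {k} → Vector Carrier k → Vector ℕ k → Carrier
  monomial {k} β e = Π (allFin k) (λ i → β i ^′ e i)

  monomial-suc : ∀ {k} (β : Vector Carrier (suc k)) e → monomial β e ≈ β zero ^′ e zero * monomial (β ∘ suc) (e ∘ suc)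
  monomial-suc {k} β e = reflexive (≡.trans (≡.cong (λ is → Π is f) (allFin-suc k)) (≡.cong (f zero *_) (Π-map suc (allFin k) f)))
    where f = λ i → β i ^′ e i

  monomial-+ : ∀ {k} (β : Vector Carrier k) e e′ → monomial β (λ i → e i ℕ.+ e′ i) ≈ monomial β e * monomial β e′
  monomial-+ {k} β e e′ = trans (Π-cong (allFin k) (λ i → ^-+ (β i) (e i) (e′ i))) (Π-* (allFin k) _ _)

  monomial-0 : ∀ {k} (β : Vector Carrier k) → monomial β (λ _ → 0) ≈ 1#
  monomial-0 {k} β = Π-1 (allFin k)

  monomial-cong : ∀ {k} (β : Vector Carrier k) {e e′} → (∀ i → e i ≡ e′ i) → monomial β e ≈ monomial β e′
  monomial-cong {k} β h = Π-cong (allFin k) (λ i → reflexive (≡.cong (β i ^′_) (h i)))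

  monomial-updateAt : ∀ {k} (β : Vector Carrier k) e i m → monomial β (updateAt e i (m ℕ.+_)) ≈ β i ^′ m * monomial β e
  monomial-updateAt {suc k} β e zero m = begin
    monomial β (updateAt e zero (m ℕ.+_))                  ≈⟨ monomial-suc β (updateAt e zero (m ℕ.+_)) ⟩
    β zero ^′ (m ℕ.+ e zero) * monomial (β ∘ suc) (e ∘ suc) ≈⟨ *-congʳ (^-+ (β zero) m (e zero)) ⟩
    β zero ^′ m * β zero ^′ e zero * monomial (β ∘ suc) (e ∘ suc) ≈⟨ *-assoc _ _ _ ⟩
    β zero ^′ m * (β zero ^′ e zero * monomial (β ∘ suc) (e ∘ suc)) ≈⟨ *-congˡ (monomial-suc β e) ⟨
    β zero ^′ m * monomial β e                             ∎
  monomial-updateAt {suc k} β e (suc i) m = begin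
    monomial β (updateAt e (suc i) (m ℕ.+_))               ≈⟨ monomial-suc β (updateAt e (suc i) (m ℕ.+_)) ⟩
    β zero ^′ e zero * monomial (β ∘ suc) (updateAt (e ∘ suc) i (m ℕ.+_)) ≈⟨ *-congˡ (monomial-updateAt (β ∘ suc) (e ∘ suc) i m) ⟩
    β zero ^′ e zero * (β (suc i) ^′ m * monomial (β ∘ suc) (e ∘ suc)) ≈⟨ solve 3 (λ x y z → x :* (y :* z) := y :* (x :* z)) refl _ _ _ ⟩
    β (suc i) ^′ m * (β zero ^′ e zero * monomial (β ∘ suc) (e ∘ suc)) ≈⟨ *-congˡ (monomial-suc β e) ⟨
    β (suc i) ^′ m * monomial β e                          ∎

  -- The sum over all orderings of `xs` when k is its length; smaller k occur in the recursion.
  symmetrise : ∀ k → List Carrier → (Vector Carrier k → Carrier) → Carrier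
  symmetrise k xs f = Σ (arrangements k xs) (f ∘ proj₁)

  -- Let the last-chosen index range over all of xs, then remove the terms in which it coincides with an earlier one.
  symmetrise-monomial-suc : ∀ k xs (e : Vector ℕ (suc k)) →
    symmetrise (suc k) xs (λ v → monomial v e) ≈
    powerSum xs (e zero) * symmetrise k xs (λ v → monomial v (e ∘ suc))
      - Σ (allFin k) (λ i → symmetrise k xs (λ v → monomial v (updateAt (e ∘ suc) i (e zero ℕ.+_))))
  symmetrise-monomial-suc k xs e = begin
    symmetrise (suc k) xs (λ v → monomial v e)
      ≈⟨ BigOperator.big-concatMap +-commutativeMonoid _ (arrangements k xs) _ ⟩
    Σ (arrangements k xs) (λ (v , ys) → Σ (map (λ (z , zs) → z ◂ v , zs) (picks ys)) (λ (v , _) → monomial v e))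
      ≈⟨ Σ-cong (arrangements k xs) (λ (v , ys) → trans (reflexive (Σ-map _ (picks ys) _)) (inner v ys)) ⟩
    Σ (arrangements k xs) (λ (v , ys) → Σ ys (_^′ m) * monomial v e′)
      ≈⟨ Σ-cong-All (All.map (λ {(v , ys)} p → term v ys p) (arrangements-↭ k xs)) ⟩
    Σ (arrangements k xs) (λ (v , ys) → powerSum xs m * monomial v e′ - Σ (allFin k) (λ i → monomial v (updateAt e′ i (m ℕ.+_))))
      ≈⟨ Σ-sub (arrangements k xs) _ _ ⟩
    Σ (arrangements k xs) (λ (v , ys) → powerSum xs m * monomial v e′)
      - Σ (arrangements k xs) (λ (v , ys) → Σ (allFin k) (λ i → monomial v (updateAt e′ i (m ℕ.+_))))
      ≈⟨ +-cong (Σ-*ˡ (powerSum xs m) (arrangements k xs) _) (-‿cong (Σ-swap (arrangements k xs) (allFin k) _)) ⟩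
    _ ∎
    where
    m  = e zero
    e′ = e ∘ suc
    inner : ∀ v ys → Σ (picks ys) (λ (z , _) → monomial (z ◂ v) e) ≈ Σ ys (_^′ m) * monomial v e′
    inner v ys = begin
      Σ (picks ys) (λ (z , _) → monomial (z ◂ v) e)         ≈⟨ Σ-cong (picks ys) (λ (z , _) → monomial-suc (z ◂ v) e) ⟩
      Σ (picks ys) (λ (z , _) → z ^′ m * monomial v e′)     ≈⟨ Σ-picks ys (λ z → z ^′ m * monomial v e′) ⟩
      Σ ys (λ z → z ^′ m * monomial v e′)                   ≈⟨ Σ-*ʳ (monomial v e′) ys (_^′ m) ⟩
      Σ ys (_^′ m) * monomial v e′                          ∎
    term : ∀ v ys → tabulate v ++ ys ↭ xs → Σ ys (_^′ m) * monomial v e′ ≈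
      powerSum xs m * monomial v e′ - Σ (allFin k) (λ i → monomial v (updateAt e′ i (m ℕ.+_)))
    term v ys p = begin
      Σ ys (_^′ m) * q                         ≈⟨ solve 3 (λ x y z → x :* y := (z :+ x) :* y :- z :* y) refl _ q s ⟩
      (s + Σ ys (_^′ m)) * q - s * q           ≈⟨ +-cong (*-congʳ s+rest) (-‿cong s*q) ⟩
      powerSum xs m * q - Σ (allFin k) (λ i → monomial v (updateAt e′ i (m ℕ.+_))) ∎
      where
      q = monomial v e′
      s = Σ (allFin k) (λ i → v i ^′ m)
      s+rest : s + Σ ys (_^′ m) ≈ powerSum xs m
      s+rest = begin
        s + Σ ys (_^′ m)                            ≡⟨ ≡.cong (_+ Σ ys (_^′ m)) (≡.trans (≡.sym (Σ-map v (allFin k) (_^′ m))) (≡.cong (λ l → Σ l (_^′ m)) (map-tabulate id v))) ⟩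
        Σ (tabulate v) (_^′ m) + Σ ys (_^′ m)       ≈⟨ Σ-++ (tabulate v) ys (_^′ m) ⟨
        Σ (tabulate v ++ ys) (_^′ m)                ≈⟨ Σ-↭ (_^′ m) p ⟩
        powerSum xs m                               ∎
      s*q : s * q ≈ Σ (allFin k) (λ i → monomial v (updateAt e′ i (m ℕ.+_)))
      s*q = trans (sym (Σ-*ʳ q (allFin k) _)) (Σ-cong (allFin k) (λ i → sym (monomial-updateAt v e′ i m)))

  -- Functions given by polynomials with integer coefficients. Subtraction alone generates them from
  -- monomials: 0 is a difference of equal terms, and a sum is x - (0 - y).
  data Polynomial {k} : (Vector Carrier k → Carrier) → Set (c Level.⊔ ℓ) where
    mono : ∀ {f} e → (∀ β → f β ≈ monomial β e) → Polynomial f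
    sub  : ∀ {f g h} → Polynomial g → Polynomial h → (∀ β → f β ≈ g β - h β) → Polynomial f

  Polynomial-1 : ∀ {k} → Polynomial {k} (λ _ → 1#)
  Polynomial-1 = mono (λ _ → 0) (λ β → sym (monomial-0 β))

  Polynomial-* : ∀ {k} {f g : Vector Carrier k → Carrier} → Polynomial f → Polynomial g → Polynomial (λ β → f β * g β)
  Polynomial-* (mono e h) (mono e′ h′) = mono (λ i → e i ℕ.+ e′ i) λ β →
    trans (*-cong (h β) (h′ β)) (sym (monomial-+ β e e′))
  Polynomial-* p@(mono e h) (sub q r h′) = sub (Polynomial-* p q) (Polynomial-* p r) λ β →
    trans (*-congˡ (h′ β)) (solve 3 (λ x y z → x :* (y :- z) := x :* y :- x :* z) refl _ _ _)
  Polynomial-* (sub p q h) r = sub (Polynomial-* p r) (Polynomial-* q r) λ β →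
    trans (*-congʳ (h β)) (solve 3 (λ x y z → (x :- y) :* z := x :* z :- y :* z) refl _ _ _)

  Polynomial-^ : ∀ {k} {f : Vector Carrier k → Carrier} → Polynomial f → ∀ n → Polynomial (λ β → f β ^′ n)
  Polynomial-^ p zero    = Polynomial-1
  Polynomial-^ p (suc n) = Polynomial-* p (Polynomial-^ p n)

  Polynomial-Π : ∀ {k} (xs : List A) {f : A → Vector Carrier k → Carrier} →
    (∀ x → Polynomial (f x)) → Polynomial (λ β → Π xs (λ x → f x β))
  Polynomial-Π []       p = Polynomial-1
  Polynomial-Π (x ∷ xs) p = Polynomial-* (p x) (Polynomial-Π xs p)

  module _ (xs : List Carrier) (power-sums : ∀ n → Integral (powerSum xs n)) where

    -- Each use of the recursion removes one variable, either as a power sum or by merging its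
    -- exponent into that of another variable, until no variable is left.
    symmetrise-monomial-Integral : ∀ k e → Integral (symmetrise k xs (λ v → monomial v e))
    symmetrise-monomial-Integral zero    e = Integral-resp (+-identityʳ _) Integral-1
    symmetrise-monomial-Integral (suc k) e = Integral-resp (symmetrise-monomial-suc k xs e)
      (Integral-sub (Integral-* (power-sums (e zero)) (symmetrise-monomial-Integral k (e ∘ suc)))
                  (Σ-Integral (allFin k) _ (λ i → symmetrise-monomial-Integral k (updateAt (e ∘ suc) i (e zero ℕ.+_)))))

    symmetrise-Integral : ∀ {k f} → Polynomial f → Integral (symmetrise k xs f)
    symmetrise-Integral {k} (mono e h)  = Integral-resp (Σ-cong (arrangements k xs) (h ∘ proj₁)) (symmetrise-monomial-Integral k e)
    symmetrise-Integral {k} (sub p q h) = Integral-resp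
      (trans (Σ-cong (arrangements k xs) (h ∘ proj₁)) (Σ-sub (arrangements k xs) _ _))
      (Integral-sub (symmetrise-Integral p) (symmetrise-Integral q))

  module Domain (no-zero-divisors : ∀ x y → x * y ≈ 0# → x ≈ 0# ⊎ y ≈ 0#) (char-0 : ∀ z → ι z ≈ 0# → z ≡ 0ℤ) where

    *-cancelˡ : ∀ {x y z} → ¬ (x ≈ 0#) → x * y ≈ x * z → y ≈ z
    *-cancelˡ {x} {y} {z} x≉0 eq with no-zero-divisors x (y - z) (begin
      x * (y - z)       ≈⟨ solve 3 (λ x y z → x :* (y :- z) := x :* y :- x :* z) refl x y z ⟩
      x * y - x * z     ≈⟨ +-congʳ eq ⟩
      x * z - x * z     ≈⟨ -‿inverseʳ _ ⟩
      0#                ∎)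
    ... | inj₁ x≈0 = contradiction x≈0 x≉0
    ... | inj₂ y-z≈0 = begin
      y             ≈⟨ solve 2 (λ y z → y := (y :- z) :+ z) refl y z ⟩
      (y - z) + z   ≈⟨ +-congʳ y-z≈0 ⟩
      0# + z        ≈⟨ +-identityˡ z ⟩
      z             ∎

    ι-injective : ∀ i j → ι i ≈ ι j → i ≡ j
    ι-injective i j eq = ℤₚ.i-j≡0⇒i≡j i j (char-0 (i ℤ.- j) (begin
      ι (i ℤ.- j)          ≈⟨ ι-+ i (ℤ.- j) ⟩
      ι i + ι (ℤ.- j)      ≈⟨ +-cong eq (ι-neg j) ⟩
      ι j - ι j            ≈⟨ -‿inverseʳ _ ⟩
      0#                   ∎))

    -- With D c = z, the hypothesis gives z^(N+1) = D^N · (D c^(N+1)) with an integral last factor, for every N.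
    bounded-denominator⇒Integral : ∀ D → ¬ (D ≡ 0) → ∀ x → (∀ N → Integral (ιℕ D * x ^′ N)) → Integral x
    bounded-denominator⇒Integral D D≢0 x int = integral (∣ᵤ⇒∣ {+ D} {z} (∣-of-powers D ℤ.∣ z ∣ (ℕ.≢-nonZero D≢0) powers))
      where
      z = proj₁ (int 1)
      Dx≈z : ιℕ D * x ≈ ι z
      Dx≈z = trans (*-congˡ (sym (*-identityʳ x))) (proj₂ (int 1))
      powers : ∀ N → D ℕ.^ N ∣ ℤ.∣ z ∣ ℕ.^ suc N
      powers N = ≡.subst₂ _∣_ (abs-^ (+ D) N) (abs-^ z (suc N))
        (≡.subst (λ t → ℤ.∣ (+ D) ℤ.^ N ∣ ∣ ℤ.∣ t ∣) (≡.sym eq)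
          (≡.subst (ℤ.∣ (+ D) ℤ.^ N ∣ ∣_) (≡.sym (ℤₚ.abs-* ((+ D) ℤ.^ N) y)) (m∣m*n _)))
        where
        y = proj₁ (int (suc N))
        eq : z ℤ.^ suc N ≡ (+ D) ℤ.^ N ℤ.* y
        eq = ι-injective _ _ (begin
          ι (z ℤ.^ suc N)                            ≈⟨ ι-^ z (suc N) ⟩
          ι z ^′ suc N                               ≈⟨ ^-cong (suc N) Dx≈z ⟨
          (ιℕ D * x) ^′ suc N                        ≈⟨ ^-*-distrib (ιℕ D) x (suc N) ⟩
          ιℕ D * ιℕ D ^′ N * (x ^′ suc N)            ≈⟨ solve 3 (λ a b c → a :* b :* c := b :* (a :* c)) refl _ _ _ ⟩
          ιℕ D ^′ N * (ιℕ D * x ^′ suc N)            ≈⟨ *-cong (sym (ι-^ (+ D) N)) (proj₂ (int (suc N))) ⟩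
          ι ((+ D) ℤ.^ N) * ι y                        ≈⟨ ι-* ((+ D) ℤ.^ N) y ⟨
          ι ((+ D) ℤ.^ N ℤ.* y)                        ∎)
      integral : _ → Integral x
      integral (divides q z≡qD) = q , *-cancelˡ (λ D≈0 → D≢0 (ℤₚ.+-injective (char-0 (+ D) D≈0))) (begin
        ιℕ D * x          ≈⟨ Dx≈z ⟩
        ι z               ≡⟨ ≡.cong ι z≡qD ⟩
        ι (q ℤ.* + D)     ≈⟨ ι-* q (+ D) ⟩
        ι q * ιℕ D        ≈⟨ *-comm _ _ ⟩
        ιℕ D * ι q        ∎)

    -- Constancy of f on the orderings of the given list is all that is asked. This can be checked
    -- after substituting the roots, where cancellation in `K` is possible, instead of for formal
    -- polynomials.
    invariant-Integral : ∀ {k f} xs → length xs ≡ k → (∀ n → Integral (powerSum xs n)) → Polynomial {k} f →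
      ∀ x → (∀ β → tabulate β ↭ xs → f β ≈ x) → Integral x
    invariant-Integral {k} {f} xs |xs|≡k power-sums p x inv =
      bounded-denominator⇒Integral D (λ D≡0 → ℕₚ.<⇒≢ (arrangements-nonempty k xs (ℕₚ.≤-reflexive (≡.sym |xs|≡k))) (≡.sym D≡0)) x λ N →
        Integral-resp (begin
          ιℕ D * x ^′ N                         ≈⟨ Σ-const (x ^′ N) (arrangements k xs) ⟨
          Σ (arrangements k xs) (λ _ → x ^′ N)  ≈⟨ Σ-cong-All (All.map (λ {(β , _)} q → ^-cong N (sym (inv β q))) (arrangements-full xs |xs|≡k)) ⟩
          symmetrise k xs (λ β → f β ^′ N)      ∎)
        (symmetrise-Integral xs power-sums (Polynomial-^ p N))
      where D = length (arrangements k xs)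

-- Factorisation and symmetry of the resultant.

module Resultant {c ℓ} (K : CommutativeRing c ℓ) (d : ℕ) where
  open CommutativeRing K hiding (zero) renaming (_*_ to _·_)
  open Poly K
  open Integers K
  open Solver
  open Symmetric K
  open import Relation.Binary.Reasoning.Setoid setoid

  -- The function f is arbitrary because the induction absorbs the newest index into it, as a
  -- product over j. It must respect `≈`, since a root and its monomial agree only up to `≈`.
  Π-roots : ∀ β ms f → (∀ {x y} → x ≈ y → f x ≈ f y) →
    Π (UDef.roots K d β ms) f ≈ Π (exponents d ms) (f ∘ monomial β)
  Π-roots β []       f f-cong = *-congʳ (f-cong (sym (monomial-0 β)))
  Π-roots β (m ∷ ms) f f-cong = begin
    Π (roots (m ∷ ms)) f
      ≈⟨ Π-concatMap-map (λ t j → β j ^′ m · t) (roots ms) (allFin d) f ⟩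
    Π (roots ms) (λ t → Π (allFin d) (λ j → f (β j ^′ m · t)))
      ≈⟨ Π-roots β ms _ (λ x≈y → Π-cong (allFin d) (λ j → f-cong (*-congˡ x≈y))) ⟩
    Π (exponents d ms) (λ u → Π (allFin d) (λ j → f (β j ^′ m · monomial β u)))
      ≈⟨ Π-cong (exponents d ms) (λ u → Π-cong (allFin d) (λ j → f-cong (sym (monomial-updateAt β u j m)))) ⟩
    Π (exponents d ms) (λ u → Π (allFin d) (λ j → f (monomial β (updateAt u j (m ℕ.+_)))))
      ≈⟨ Π-concatMap-map (λ u j → updateAt u j (m ℕ.+_)) (exponents d ms) (allFin d) (f ∘ monomial β) ⟨
    Π (exponents d (m ∷ ms)) (f ∘ monomial β) ∎
    where open UDef K d β using (roots)

  -- The two lists of roots come in different orders. Once f has absorbed the product over j, a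
  -- permutation only reorders that inner product.
  Π-roots-↭ : ∀ {β γ : Vector Carrier d} → tabulate β ↭ tabulate γ → ∀ ms f → (∀ {x y} → x ≈ y → f x ≈ f y) →
    Π (UDef.roots K d β ms) f ≈ Π (UDef.roots K d γ ms) f
  Π-roots-↭ β↭γ []       f f-cong = refl
  Π-roots-↭ {β} {γ} β↭γ (m ∷ ms) f f-cong = begin
    Π (UDef.roots K d β (m ∷ ms)) f
      ≈⟨ Π-concatMap-map (λ t j → β j ^′ m · t) (UDef.roots K d β ms) (allFin d) f ⟩
    Π (UDef.roots K d β ms) (λ t → Π (allFin d) (λ j → f (β j ^′ m · t)))
      ≈⟨ Π-roots-↭ β↭γ ms _ (λ x≈y → Π-cong (allFin d) (λ j → f-cong (*-congˡ x≈y))) ⟩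
    Π (UDef.roots K d γ ms) (λ t → Π (allFin d) (λ j → f (β j ^′ m · t)))
      ≈⟨ Π-cong (UDef.roots K d γ ms) (λ t → reindex (λ x → f (x ^′ m · t))) ⟩
    Π (UDef.roots K d γ ms) (λ t → Π (allFin d) (λ j → f (γ j ^′ m · t)))
      ≈⟨ Π-concatMap-map (λ t j → γ j ^′ m · t) (UDef.roots K d γ ms) (allFin d) f ⟨
    Π (UDef.roots K d γ (m ∷ ms)) f ∎
    where
    Π-tabulate : ∀ (δ : Vector Carrier d) g → Π (allFin d) (g ∘ δ) ≡ Π (tabulate δ) g
    Π-tabulate δ g = ≡.trans (≡.sym (Π-map δ (allFin d) g)) (≡.cong (λ xs → Π xs g) (map-tabulate id δ))
    reindex : ∀ g → Π (allFin d) (g ∘ β) ≈ Π (allFin d) (g ∘ γ)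
    reindex g = begin
      Π (allFin d) (g ∘ β)  ≡⟨ Π-tabulate β g ⟩
      Π (tabulate β) g      ≈⟨ Π-↭ g β↭γ ⟩
      Π (tabulate γ) g      ≡⟨ Π-tabulate γ g ⟨
      Π (allFin d) (g ∘ γ)  ∎

  Res-Π : ∀ β as bs → UDef.Res K d β as bs ≈ Π as (λ x → Π bs (λ y → x - y))
  Res-Π β as bs = trans (reflexive (≡.cong prodR (≡.sym (map-id (concatMap (λ x → map (λ y → x - y) bs) as))))) (Π-concatMap-map _-_ as bs id)

  sub-cong : ∀ {x x′ y y′} → x ≈ x′ → y ≈ y′ → x - y ≈ x′ - y′
  sub-cong p q = +-cong p (-‿cong q)

  Res-↭ : ∀ {β γ : Vector Carrier d} → tabulate β ↭ tabulate γ → ∀ ms ns →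
    UDef.Res K d β (UDef.roots K d β ms) (UDef.roots K d β ns) ≈ UDef.Res K d γ (UDef.roots K d γ ms) (UDef.roots K d γ ns)
  Res-↭ {β} {γ} β↭γ ms ns = begin
    UDef.Res K d β (Rβ ms) (Rβ ns)              ≈⟨ Res-Π β (Rβ ms) (Rβ ns) ⟩
    Π (Rβ ms) (λ x → Π (Rβ ns) (λ y → x - y))   ≈⟨ Π-cong (Rβ ms) (λ x → Π-roots-↭ β↭γ ns (λ y → x - y) (λ q → sub-cong refl q)) ⟩
    Π (Rβ ms) (λ x → Π (Rγ ns) (λ y → x - y))   ≈⟨ Π-roots-↭ β↭γ ms _ (λ p → Π-cong (Rγ ns) (λ y → sub-cong p refl)) ⟩
    Π (Rγ ms) (λ x → Π (Rγ ns) (λ y → x - y))   ≈⟨ Res-Π γ (Rγ ms) (Rγ ns) ⟨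
    UDef.Res K d γ (Rγ ms) (Rγ ns)              ∎
    where
    Rβ = UDef.roots K d β
    Rγ = UDef.roots K d γ

  Π-monomial : ∀ {a} {A : Set a} β (xs : List A) (e : A → Vector ℕ d) →
    Π xs (λ x → monomial β (e x)) ≈ monomial β (λ i → BigOperator.big ℕₚ.+-0-commutativeMonoid xs (λ x → e x i))
  Π-monomial β []       e = sym (monomial-0 β)
  Π-monomial β (x ∷ xs) e = trans (*-congˡ (Π-monomial β xs e)) (sym (monomial-+ β (e x) _))

  monomial-const : ∀ β E → monomial β (λ _ → E) ≈ Π (allFin d) β ^′ E
  monomial-const β zero    = monomial-0 β
  monomial-const β (suc E) = trans (Π-* (allFin d) β (λ i → β i ^′ E)) (*-congˡ (monomial-const β E))

  -- The overview's c as a function of the roots: the surplus of the extracted exponents over E,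
  -- times the differences freed from their common monomial. Truncation is correct in the latter,
  -- since u - min(u,v) is `u ∸ v`.
  cofactor : List ℕ → List ℕ → ℕ → Vector Carrier d → Carrier
  cofactor ms ns E β = monomial β (λ i → minExponent d ms ns i ∸ E) ·
    Π (exponents d ms) (λ u → Π (exponents d ns) (λ v → monomial β (λ i → u i ∸ v i) - monomial β (λ i → v i ∸ u i)))

  cofactor-Polynomial : ∀ ms ns E → Polynomial (cofactor ms ns E)
  cofactor-Polynomial ms ns E = Polynomial-* (mono (λ i → minExponent d ms ns i ∸ E) (λ _ → refl))
    (Polynomial-Π (exponents d ms) (λ u → Polynomial-Π (exponents d ns) (λ v →
      sub (mono (λ i → u i ∸ v i) (λ _ → refl)) (mono (λ i → v i ∸ u i) (λ _ → refl)) (λ _ → refl))))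

  Res-factor : ∀ ms ns E → (∀ i → E ≤ minExponent d ms ns i) → ∀ β →
    UDef.Res K d β (UDef.roots K d β ms) (UDef.roots K d β ns) ≈ Π (allFin d) β ^′ E · cofactor ms ns E β
  Res-factor ms ns E E≤ β = begin
    UDef.Res K d β (R ms) (R ns)
      ≈⟨ Res-Π β (R ms) (R ns) ⟩
    Π (R ms) (λ x → Π (R ns) (λ y → x - y))
      ≈⟨ Π-cong (R ms) (λ x → Π-roots β ns (λ y → x - y) (λ q → sub-cong refl q)) ⟩
    Π (R ms) (λ x → Π ens (λ v → x - monomial β v))
      ≈⟨ Π-roots β ms _ (λ p → Π-cong ens (λ v → sub-cong p refl)) ⟩
    Π ems (λ u → Π ens (λ v → monomial β u - monomial β v))
      ≈⟨ Π-cong ems (λ u → trans (Π-cong ens (split u)) (Π-* ens _ _)) ⟩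
    Π ems (λ u → Π ens (λ v → monomial β (u ∧ v)) · Π ens (λ v → monomial β (u ⊖ v) - monomial β (v ⊖ u)))
      ≈⟨ Π-* ems _ _ ⟩
    Π ems (λ u → Π ens (λ v → monomial β (u ∧ v))) · rest
      ≈⟨ *-congʳ (trans (Π-cong ems (λ u → Π-monomial β ens (u ∧_))) (Π-monomial β ems _)) ⟩
    monomial β T · rest
      -- The bound on E makes the truncated difference exact: E + (T_i ∸ E) = T_i.
      ≈⟨ *-congʳ (trans (monomial-cong β (λ i → ≡.sym (ℕₚ.m+[n∸m]≡n (E≤ i)))) (monomial-+ β (λ _ → E) (λ i → T i ∸ E))) ⟩
    monomial β (λ _ → E) · monomial β (λ i → T i ∸ E) · rest
      ≈⟨ trans (*-assoc _ _ _) (*-congʳ (monomial-const β E)) ⟩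
    Π (allFin d) β ^′ E · cofactor ms ns E β ∎
    where
    R   = UDef.roots K d β
    ems = exponents d ms
    ens = exponents d ns
    T   = minExponent d ms ns
    _∧_ _⊖_ : Vector ℕ d → Vector ℕ d → Vector ℕ d
    (u ∧ v) i = u i ⊓ v i
    (u ⊖ v) i = u i ∸ v i
    rest = Π ems (λ u → Π ens (λ v → monomial β (u ⊖ v) - monomial β (v ⊖ u)))
    split : ∀ u v → monomial β u - monomial β v ≈ monomial β (u ∧ v) · (monomial β (u ⊖ v) - monomial β (v ⊖ u))
    split u v = begin
      monomial β u - monomial β v
        ≈⟨ sub-cong (trans (monomial-cong β (λ i → ≡.sym (≡.trans (≡.cong (ℕ._+ (u i ∸ v i)) (ℕₚ.⊓-comm (u i) (v i))) (ℕₚ.m⊓n+n∸m≡n (v i) (u i))))) (monomial-+ β (u ∧ v) (u ⊖ v)))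
                  (trans (monomial-cong β (λ i → ≡.sym (ℕₚ.m⊓n+n∸m≡n (u i) (v i)))) (monomial-+ β (u ∧ v) (v ⊖ u))) ⟩
      monomial β (u ∧ v) · monomial β (u ⊖ v) - monomial β (u ∧ v) · monomial β (v ⊖ u)
        ≈⟨ solve 3 (λ x y z → x :* y :- x :* z := x :* (y :- z)) refl _ _ _ ⟩
      monomial β (u ∧ v) · (monomial β (u ⊖ v) - monomial β (v ⊖ u)) ∎

-- Divisibility of the resultant by the power of the constant coefficient.

ℤ-^-distribʳ-* : ∀ i j n → (i ℤ.* j) ℤ.^ n ≡ i ℤ.^ n ℤ.* j ℤ.^ n
ℤ-^-distribʳ-* i j zero    = ≡.refl
ℤ-^-distribʳ-* i j (suc n) = ≡.trans (≡.cong (i ℤ.* j ℤ.*_) (ℤ-^-distribʳ-* i j n)) (interchange i j (i ℤ.^ n) (j ℤ.^ n))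
  where open import Algebra.Properties.CommutativeSemigroup ℤₚ.*-commutativeSemigroup using (interchange)

exponent-≤ : ∀ d n → 1 < n → ∀ i → exponent d n ≤ minExponent d (𝒟₊ n) (𝒟₋ n) i
exponent-≤ d n@(suc _) 1<n = minExponent-≥ d (𝒟₊ n) (𝒟₋ n)
  (ℕₚ.^-monoʳ-≤ 2 (ω-pos n 1<n)) (2^ω≤length n) (sum-𝒟≥ n true 1<n) (sum-𝒟≥ n false 1<n)

coeff-map-ι₀ : ∀ {c ℓ} (K : CommutativeRing c ℓ) zs →
  Poly.coeff K (map (Poly.ι K) zs) 0 ≡ Poly.ι K (ℤP.coeff zs 0)
coeff-map-ι₀ K []       = ≡.refl
coeff-map-ι₀ K (z ∷ zs) = ≡.refl

open import Data.Integer using (+_; _^_; _*_)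

theorem4p8 : ∀ {c ℓ : Level} (K : CommutativeRing c ℓ) →
  let open CommutativeRing K renaming (_*_ to _·_) in
  let open Poly K in
  -- K is an integral domain of characteristic 0
  ¬ (1# ≈ 0#) →
  (∀ x y → x · y ≈ 0# → x ≈ 0# ⊎ y ≈ 0#) →
  (∀ z → ι z ≈ 0# → z ≡ + 0) →
  -- P = x^d + a_{d-1} x^{d-1} + … + a_0 monic irreducible in ℤ[x]
  (d : ℕ) (a : Fin d → ℤ) → IrreducibleℤX (monic d a) →
  -- α₁ … α_d are the roots of P in K:  P = ∏ (x - α_i) in K[x]
  (α : Fin d → Carrier) →
  map ι (monic d a) ≈ₚ prodₚ (map (λ i → X- α i) (allFin d)) →
  (n : ℕ) → 1 < n →
  -- U(n) = a_0^(n' 2^(2(l-1)) d^(2^l-2)) · q for some integer q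
  ∃ λ (q : ℤ) →
    UDef.U K d α n ≈ ι ((ℤP.coeff (monic d a) 0 ^ exponent d n) * q)
theorem4p8 K _ no-zero-divisors char-0 d a _ α P≈ n 1<n = result (coeff₀-fromRoots as)
  where
  open CommutativeRing K hiding (zero) renaming (_*_ to _·_)
  open Poly K
  open Integers K
  open Newton K
  open Symmetric K
  open Domain no-zero-divisors char-0
  open Resultant K d
  open import Relation.Binary.Reasoning.Setoid setoid

  as = map α (allFin d)
  as≡ : as ≡ tabulate α
  as≡ = map-tabulate id α
  zs = map a (allFin d)
  P≈fromRoots : map ι (zs ++ 1ℤ ∷ []) ≈ₚ fromRoots as
  P≈fromRoots k = trans (P≈ k) (reflexive (≡.cong (λ fs → coeff (prodₚ fs) k) (map-∘ (allFin d))))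
  a₀ = ℤP.coeff (monic d a) 0
  E  = exponent d n
  ∏α = prodR as
  U  = UDef.U K d
  c  = cofactor (𝒟₊ n) (𝒟₋ n) E
  U-factor : ∀ β → U β n ≈ Π (allFin d) β ^′ E · c β
  U-factor = Res-factor (𝒟₊ n) (𝒟₋ n) E (exponent-≤ d n 1<n)

  ∏α^E-invariant : ∀ β → tabulate β ↭ as → Π (allFin d) β ^′ E ≈ ∏α ^′ E
  ∏α^E-invariant β p = ^-cong E (begin
    Π (allFin d) β      ≡⟨ ≡.cong prodR (map-tabulate id β) ⟩
    prodR (tabulate β)  ≡⟨ ≡.cong prodR (map-id (tabulate β)) ⟨
    Π (tabulate β) id   ≈⟨ Π-↭ id p ⟩
    Π as id             ≡⟨ ≡.cong prodR (map-id as) ⟩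
    prodR as            ∎)

  -- ∏α^E c(β) = U(β) is symmetric and ∏α^E ≠ 0 can be cancelled.
  cofactor-invariant : ¬ (∏α ^′ E ≈ 0#) → ∀ β → tabulate β ↭ as → c β ≈ c α
  cofactor-invariant ∏α^E≉0 β p = *-cancelˡ ∏α^E≉0 (begin
    ∏α ^′ E · c β                   ≈⟨ *-congʳ (∏α^E-invariant β p) ⟨
    Π (allFin d) β ^′ E · c β       ≈⟨ U-factor β ⟨
    U β n                           ≈⟨ Res-↭ (≡.subst (tabulate β ↭_) as≡ p) (𝒟₊ n) (𝒟₋ n) ⟩
    U α n                           ≈⟨ U-factor α ⟩
    ∏α ^′ E · c α                   ∎)

  module Constant (s : ℤ) (ss≡1 : s * s ≡ 1ℤ) (coeff₀≈ : coeff (fromRoots as) 0 ≈ ι s · ∏α) where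
    ιa₀≈ : ι a₀ ≈ ι s · ∏α
    ιa₀≈ = trans (reflexive (≡.sym (coeff-map-ι₀ K (monic d a)))) (trans (P≈fromRoots 0) coeff₀≈)
    ∏α≈ : ∏α ≈ ι (s * a₀)
    ∏α≈ = begin
      ∏α                ≈⟨ *-identityˡ ∏α ⟨
      1# · ∏α           ≈⟨ *-congʳ ι-1 ⟨
      ι 1ℤ · ∏α         ≡⟨ ≡.cong (λ x → ι x · ∏α) ss≡1 ⟨
      ι (s * s) · ∏α    ≈⟨ *-congʳ (ι-* s s) ⟩
      ι s · ι s · ∏α    ≈⟨ *-assoc _ _ _ ⟩
      ι s · (ι s · ∏α)  ≈⟨ *-congˡ ιa₀≈ ⟨
      ι s · ι a₀       ≈⟨ ι-* s a₀ ⟨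
      ι (s * a₀)       ∎
    ∏α^E≈ : ∏α ^′ E ≈ ι (s ^ E * a₀ ^ E)
    ∏α^E≈ = trans (^-cong E ∏α≈) (trans (sym (ι-^ (s * a₀) E)) (reflexive (≡.cong ι (ℤ-^-distribʳ-* s a₀ E))))
    U≈ : U α n ≈ ι (s ^ E * a₀ ^ E) · c α
    U≈ = trans (U-factor α) (*-congʳ ∏α^E≈)
    ∏α^E≈0⇒a₀^E≡0 : ∏α ^′ E ≈ 0# → a₀ ^ E ≡ 0ℤ
    ∏α^E≈0⇒a₀^E≡0 ∏α^E≈0 = char-0 (a₀ ^ E) (begin
      ι (a₀ ^ E)             ≈⟨ ι-^ a₀ E ⟩
      ι a₀ ^′ E              ≈⟨ ^-cong E ιa₀≈ ⟩
      (ι s · ∏α) ^′ E         ≈⟨ ^-*-distrib (ι s) ∏α E ⟩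
      ι s ^′ E · ∏α ^′ E      ≈⟨ *-congˡ ∏α^E≈0 ⟩
      ι s ^′ E · 0#          ≈⟨ zeroʳ _ ⟩
      0#                     ∎)

  result : (∃ λ s → s * s ≡ 1ℤ × coeff (fromRoots as) 0 ≈ ι s · ∏α) → ∃ λ q → U α n ≈ ι (a₀ ^ E * q)
  -- The case distinction is made in ℤ, since equality in `K` need not be decidable. A nonzero power
  -- of a₀ makes the same power of the product of the roots nonzero, which permits the cancellation.
  result (s , ss≡1 , coeff₀≈) with a₀ ^ E ℤ.≟ 0ℤ
  ... | yes a₀^E≡0 = 0ℤ , (begin
    U α n                       ≈⟨ U≈ ⟩
    ι (s ^ E * a₀ ^ E) · c α    ≡⟨ ≡.cong (λ x → ι x · c α) (≡.trans (≡.cong (s ^ E *_) a₀^E≡0) (ℤₚ.*-zeroʳ (s ^ E))) ⟩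
    0# · c α                    ≈⟨ zeroˡ _ ⟩
    ι 0ℤ                        ≡⟨ ≡.cong ι (ℤₚ.*-zeroʳ (a₀ ^ E)) ⟨
    ι (a₀ ^ E * 0ℤ)             ∎)
    where open Constant s ss≡1 coeff₀≈
  -- The quotient takes up the sign relating a₀ to the product of the roots.
  ... | no a₀^E≢0 = s ^ E * q , (begin
    U α n                       ≈⟨ U≈ ⟩
    ι (s ^ E * a₀ ^ E) · c α    ≈⟨ *-congˡ (proj₂ c-Integral) ⟩
    ι (s ^ E * a₀ ^ E) · ι q    ≈⟨ ι-* (s ^ E * a₀ ^ E) q ⟨
    ι (s ^ E * a₀ ^ E * q)      ≡⟨ ≡.cong ι (≡.trans (≡.cong (_* q) (ℤₚ.*-comm (s ^ E) (a₀ ^ E))) (ℤₚ.*-assoc (a₀ ^ E) (s ^ E) q)) ⟩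
    ι (a₀ ^ E * (s ^ E * q))    ∎)
    where
    open Constant s ss≡1 coeff₀≈
    c-Integral : Integral (c α)
    c-Integral = invariant-Integral as (≡.trans (length-map α (allFin d)) (length-allFin d))
      (powerSum-Integral zs as P≈fromRoots) (cofactor-Polynomial (𝒟₊ n) (𝒟₋ n) E) (c α)
      (cofactor-invariant (a₀^E≢0 ∘ ∏α^E≈0⇒a₀^E≡0))
    q = proj₁ c-Integral
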